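{- For every integer $k\ge1$, $$E^{k(k-1)\cdots1}_{1\text{ - }23}(x)=E^{k(k-1)\cdots1}_{1\text{ - }32}(x)=\begin{cases}\dfrac{e^{e^x}}{(k-1)!}\displaystyle\int_0^x t^{k-1}e^{ -e^t+t}\,dt,&\text{if }k\ge2,\\[2mm] e^{e^x-1},&\text{if }k=1.\end{cases}$$
   Context: For a permutation $abc$ of $\{1,2,3\}$, a permutation $\pi=\pi_1\cdots\pi_n$ of $\{1,\dots,n\}$ contains the generalized pattern $a\text{ - }bc$ if there are indices $i<j<n$ such that $\pi_i\pi_j\pi_{j+1}$ is order-isomorphic to $abc$; otherwise it avoids it. A permutation $\pi$ begins with a pattern $p=p_1\cdots p_k$ if $n\ge k$ and $\pi_1\cdots\pi_k$ is order-isomorphic to $p$; by convention, the empty permutation is also regarded as beginning with the pattern $1$ (the case $k=1$). $E^p_q(x)=\sum_{n\ge0}N^p_q(n)\frac{x^n}{n!}$, where $N^p_q(n)$ is the number of permutations of $\{1,\dots,n\}$ that avoid $q$ and begin with $p$. Identities are identities of power series in $x$. -}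

module Defs where

open import Algebra.Bundles using (CommutativeRing; RawRing)
import Algebra.Definitions.RawMonoid as RawMonoidDefs
import Algebra.Definitions.RawSemiring as RawSemiringDefs
open import Algebra.Morphism.Structures using (IsMonoidHomomorphism; IsRingHomomorphism)
open import Data.Fin.Base using (Fin; toℕ)
import Data.Fin.Base as Fin
import Data.Fin.Properties as Fin
open import Data.Integer.Base using (+_)
open import Data.List.Base using (List; []; _∷_; allFin; cartesianProductWith; filter; length)
open import Data.Nat.Base using (ℕ; zero; suc; _<_; _≤_; _∸_; NonZero; _!)
open import Data.Nat.Properties using (_≟_; _<?_; _≤?_; ≤-irrelevant; _!≢0)
open import Data.Product.Base using (_×_; _,_; proj₁; proj₂; ∃-syntax; Σ-syntax; uncurry)
open import Data.Rational.Base using (ℚ; _/_)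
import Data.Rational.Base as ℚ
open import Data.Sum.Base using (_⊎_)
open import Data.Vec.Base as Vec using (Vec; []; _∷_; lookup; truncate)
open import Data.Vec.Relation.Unary.AllPairs using (allPairs?)
open import Data.Vec.Relation.Unary.Unique.Propositional using (Unique)
open import Function.Bundles using (_⇔_; mk⇔; module Equivalence)
import Level
open import Level using (_⊔_)
open import Relation.Binary.PropositionalEquality using (_≡_; subst)
open import Relation.Nullary using (¬_; Dec; yes; no)
open import Relation.Nullary.Decidable using (map′; _×-dec_; _⊎-dec_; _→-dec_; ¬?)

OrderIsomorphic : ∀ {k} → Vec ℕ k → Vec ℕ k → Set
OrderIsomorphic {k} u v =
  (i j : Fin k) → (lookup u i < lookup u j) ⇔ (lookup v i < lookup v j)

orderIsomorphic? : ∀ {k} (u v : Vec ℕ k) → Dec (OrderIsomorphic u v)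
orderIsomorphic? u v = Fin.all? λ i → Fin.all? λ j →
  let a? = lookup u i <? lookup u j
      b? = lookup v i <? lookup v j
  in map′ (uncurry mk⇔) (λ e → Equivalence.to e , Equivalence.from e)
       ((a? →-dec b?) ×-dec (b? →-dec a?))

-- A word of length n over the n-element alphabet Fin n.  It is (the one-line
-- notation of) a permutation exactly when it is Unique.  The letters are
-- 0, …, n - 1 instead of 1, …, n; only their relative order is ever used.

Word : ℕ → Set
Word n = Vec (Fin n) n

letter : ∀ {n} → Word n → Fin n → ℕ
letter π i = toℕ (lookup π i)

-- The generalized pattern a-bc is represented by the word a ∷ b ∷ c ∷ [].

Contains : ∀ {n} → Vec ℕ 3 → Word n → Set
Contains {n} q π =
  ∃[ i ] ∃[ j ] ∃[ j′ ] (i Fin.< j × toℕ j′ ≡ suc (toℕ j) ×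
    OrderIsomorphic (letter π i ∷ letter π j ∷ letter π j′ ∷ []) q)

contains? : ∀ {n} (q : Vec ℕ 3) (π : Word n) → Dec (Contains q π)
contains? q π = Fin.any? λ i → Fin.any? λ j → Fin.any? λ j′ →
  (i Fin.<? j) ×-dec (toℕ j′ ≟ suc (toℕ j)) ×-dec
  orderIsomorphic? (letter π i ∷ letter π j ∷ letter π j′ ∷ []) q

Avoids : ∀ {n} → Vec ℕ 3 → Word n → Set
Avoids q π = ¬ Contains q π

avoids? : ∀ {n} (q : Vec ℕ 3) (π : Word n) → Dec (Avoids q π)
avoids? q π = ¬? (contains? q π)

-- The second alternative is the convention that the empty permutation begins
-- with the pattern of length 1.

BeginsWith : ∀ {k n} → Vec ℕ k → Word n → Set
BeginsWith {k} {n} p π =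
  (Σ[ k≤n ∈ k ≤ n ] OrderIsomorphic (truncate k≤n (Vec.map toℕ π)) p)
  ⊎ (n ≡ 0 × k ≡ 1)

beginsWith? : ∀ {k n} (p : Vec ℕ k) (π : Word n) → Dec (BeginsWith p π)
beginsWith? {k} {n} p π = prefix? ⊎-dec ((n ≟ 0) ×-dec (k ≟ 1))
  where
  w = Vec.map toℕ π

  prefix? : Dec (Σ[ k≤n ∈ k ≤ n ] OrderIsomorphic (truncate k≤n w) p)
  prefix? with k ≤? n
  ... | no  k≰n = no λ s → k≰n (proj₁ s)
  ... | yes k≤n = map′ (k≤n ,_)
    (λ s → subst (λ r → OrderIsomorphic (truncate r w) p)
                 (≤-irrelevant (proj₁ s) k≤n) (proj₂ s))
    (orderIsomorphic? (truncate k≤n w) p)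

words : ∀ {A : Set} → List A → (n : ℕ) → List (Vec A n)
words as zero    = [] ∷ []
words as (suc n) = cartesianProductWith _∷_ as (words as n)

unique? : ∀ {n} (π : Word n) → Dec (Unique π)
unique? = allPairs? λ a b → ¬? (a Fin.≟ b)

permutations : (n : ℕ) → List (Word n)
permutations n = filter unique? (words (allFin n) n)

N : ∀ {k} → Vec ℕ k → Vec ℕ 3 → ℕ → ℕ
N p q n = length
  (filter (λ π → avoids? q π ×-dec beginsWith? p π) (permutations n))

1-23 1-32 : Vec ℕ 3
1-23 = 1 ∷ 2 ∷ 3 ∷ []
1-32 = 1 ∷ 3 ∷ 2 ∷ []

descending : (k : ℕ) → Vec ℕ k
descending zero    = []
descending (suc k) = suc k ∷ descending k

1/_! : ℕ → ℚ
1/ n ! = + 1 / (n !)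
  where instance _ = n !≢0

-- A commutative ℚ-algebra with an exponential map, i.e. a homomorphism from
-- its additive to its multiplicative monoid.  The field of real numbers with
-- the usual exponential is an example.  Such a map is what gives a meaning to
-- e^f for a power series f whose constant term is not zero, as in e^(e^x).

record ExponentialℚAlgebra c ℓ : Set (Level.suc (c ⊔ ℓ)) where
  field
    commutativeRing : CommutativeRing c ℓ

  open CommutativeRing commutativeRing public

  field
    fromℚ               : ℚ → Carrier
    fromℚ-homomorphism  : IsRingHomomorphism ℚ.+-*-rawRing rawRing fromℚ
    exp                 : Carrier → Carrier
    exp-homomorphism    : IsMonoidHomomorphism +-rawMonoid *-rawMonoid exp

module PowerSeries {c ℓ} (A : ExponentialℚAlgebra c ℓ) where

  private
    module A = ExponentialℚAlgebra A
    open RawMonoidDefs A.+-rawMonoid using (sum)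

  Series : Set c
  Series = ℕ → A.Carrier

  const : A.Carrier → Series
  const a zero    = a
  const a (suc n) = A.0#

  series : RawRing c ℓ
  series = record
    { Carrier = Series
    ; _≈_     = λ f g → ∀ n → f n A.≈ g n
    ; _+_     = λ f g n → f n A.+ g n
    ; _*_     = λ f g n → sum {suc n} λ i → f (toℕ i) A.* g (n ∸ toℕ i)
    ; -_      = λ f n → A.- f n
    ; 0#      = const A.0#
    ; 1#      = const A.1#
    }

  open RawRing series public using (_≈_; _+_; _*_; -_; 0#; 1#)
  open RawSemiringDefs (RawRing.rawSemiring series) public using (_^_)

  infixl 6 _-_
  _-_ : Series → Series → Series
  f - g = f + (- g)

  infixr 7 _•_
  _•_ : ℚ → Series → Series
  (r • f) n = A.fromℚ r A.* f n

  x : Series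
  x 1 = A.1#
  x _ = A.0#

  ∫ : Series → Series
  ∫ f zero    = A.0#
  ∫ f (suc n) = A.fromℚ (+ 1 / suc n) A.* f n

  dropConstant : Series → Series
  dropConstant f zero    = A.0#
  dropConstant f (suc n) = f (suc n)

  -- e^f = exp (f 0) · Σ_m g^m / m! where g = f - f 0.  As g has no constant
  -- term, g^m does not contribute to the coefficient of x^n when m > n.
  infix 9 e^_
  e^_ : Series → Series
  (e^ f) n = A.exp (f 0) A.*
    sum {suc n} λ m → ((1/ toℕ m !) • (dropConstant f ^ toℕ m)) n

  E : ∀ {k} → Vec ℕ k → Vec ℕ 3 → Series
  E p q n = A.fromℚ (+ N p q n / (n !))
    where instance _ = n !≢0

module Submission where

-- In a permutation avoiding 1-23 (or 1-32), the letters after the least letter m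
-- are decreasing (or increasing), while those before m only have to avoid the
-- pattern themselves.  Put d = k − 1 and let F be the generating function of the
-- permutations that begin with d descents.  Choosing the set of letters before m
-- gives F′ = e^x (F + x^d / d!); the last term, absent for d = 0, counts the words
-- whose d-th descent ends in m.  The closed form solves the same linear
-- differential equation with the same constant term, and over a ℚ-algebra such a
-- solution is unique.

open import Defs
open import Algebra.Bundles using (CommutativeRing)
open import Algebra.Morphism.Structures using (IsMonoidHomomorphism; IsRingHomomorphism)
import Algebra.Definitions.RawMonoid as RawMonoidDefs
import Algebra.Properties.Ring as RingProperties
import Algebra.Solver.Ring.NaturalCoefficients.Default as NaturalCoefficients
open import Data.Bool.Base using (if_then_else_)
open import Data.Empty using (⊥)
open import Data.Fin.Base as Fin using (Fin; toℕ) renaming (zero to 0F; suc to sucF)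
import Data.Fin.Properties as Fin
open import Data.Integer.Base as ℤ using (+_)
import Data.Integer.Properties as ℤ
import Data.Integer.Tactic.RingSolver as ℤ-Solver
open import Data.List.Base using (List; []; _∷_; _++_; length; map; allFin; filter)
open import Data.List.Membership.Propositional using (_∈_)
open import Data.List.Membership.Propositional.Properties
  using ( ∈-∃++; ∈-++⁺ˡ; ∈-++⁺ʳ; ∈-++⁻; ∈-map⁺; ∈-map⁻; ∈-filter⁺; ∈-filter⁻
        ; ∈-cartesianProductWith⁺; ∈-allFin)
import Data.List.Properties as List
open import Data.List.Relation.Binary.Permutation.Propositional
  using (_↭_; ↭-refl; ↭-sym; ↭-trans; ↭-prep; ↭⇒↭ₛ)
open import Data.List.Relation.Binary.Permutation.Propositional.Properties
  using (shift; drop-mid; ↭-length; ∈-resp-↭; ++⁺; ↭-empty-inv)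
import Data.List.Relation.Binary.Permutation.Setoid.Properties as Permutationₛ
open import Data.List.Relation.Binary.Pointwise using (Pointwise-≡⇒≡)
open import Data.List.Relation.Binary.Subset.Propositional using (_⊆_)
open import Data.List.Relation.Ternary.Interleaving.Propositional
  using (Interleaving; []; consˡ; consʳ; toPermutation)
open import Data.List.Relation.Unary.All as All using (All; []; _∷_)
import Data.List.Relation.Unary.All.Properties as All
open import Data.List.Relation.Unary.AllPairs as AllPairs using (AllPairs; []; _∷_)
import Data.List.Relation.Unary.AllPairs.Properties as AllPairs
open import Data.List.Relation.Unary.Any using (here; there)
open import Data.List.Relation.Unary.Linked as Linked using (Linked; []; [-]; _∷_)
import Data.List.Relation.Unary.Linked.Properties as Linked
open import Data.List.Relation.Unary.Sorted.TotalOrder.Properties using (↗↭↗⇒≋)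
open import Data.List.Relation.Unary.Unique.Propositional using (Unique)
import Data.List.Relation.Unary.Unique.Propositional.Properties as Unique
import Data.List.Sort as Sort
open import Data.Nat.Base as ℕ
  using (ℕ; zero; suc; NonZero; _!; _≤_; _<_; _>_; _≤ᵇ_; _∸_; z≤n; s≤s; z<s; s<s; s<s⁻¹)
open import Data.Nat.Properties as ℕ using (_!≢0)
import Data.Nat.Tactic.RingSolver as ℕ-Solver
open import Data.Product.Base using (_×_; _,_; proj₁; proj₂; ∃-syntax; Σ-syntax; uncurry)
open import Data.Rational.Base as ℚ using (_/_)
import Data.Rational.Properties as ℚ
import Data.Rational.Unnormalised.Base as ℚᵘ
import Data.Rational.Unnormalised.Properties as ℚᵘ
open import Data.Sum.Base as Sum using (_⊎_; inj₁; inj₂; [_,_]′)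
open import Data.Unit.Base using (⊤; tt)
open import Data.Vec.Base as Vec using (Vec; []; _∷_; lookup; toList; fromList; truncate)
import Data.Vec.Properties as Vec
import Data.Vec.Relation.Unary.All as Vec using (All; []; _∷_) renaming (map to map-All)
import Data.Vec.Relation.Unary.All.Properties as VecAll
import Data.Vec.Relation.Unary.AllPairs as Vec using (AllPairs; []; _∷_)
import Data.Vec.Relation.Unary.Unique.Propositional as Vec using (Unique)
open import Function.Base using (_∘_)
open import Function.Bundles using (_⇔_; mk⇔; module Equivalence)
open import Level using (0ℓ)
open import Relation.Binary using (Rel; IsDecTotalOrder; DecTotalOrder)
import Relation.Binary.Construct.Flip.EqAndOrd as Flip
open import Relation.Binary.PropositionalEquality
  using (_≡_; _≢_; refl; sym; trans; cong; cong₂; subst; setoid)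
import Relation.Binary.Reasoning.Setoid as SetoidReasoning
open import Relation.Nullary using (¬_; contradiction; yes; no)
open import Relation.Nullary.Decidable using (decidable-stable; _×-dec_)

open Equivalence using (to; from)

-- The word before the least letter uses only part of the alphabet, so it is not itself a
-- permutation of an initial segment. The induction therefore concerns arrangements of arbitrary
-- increasing lists of letters, over all alphabets `Fin k` at once, and `HasSize` carries counts
-- between predicates that are merely equivalent. The set of letters before m is recorded by an
-- `Interleaving` of the increasing list. Counting its choices by Pascal's rule mirrors, on the side
-- of series, the Leibniz rule for a product with `e^ x`. Both patterns share one argument, because
-- they differ only in the order required of the letters after m. The scalar `exp 1#` hidden in
-- `e^ (e^ x)` never has to be evaluated: it cancels against the integrand because `exp` is a
-- homomorphism.

private variable
  k n : ℕ
  A B : Set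

-- Sizes of predicates

unique-⊆⇒complement : ∀ {xs ys : List A} → Unique xs → xs ⊆ ys →
                      ∃[ zs ] ys ↭ xs ++ zs
unique-⊆⇒complement {ys = ys} [] _ = ys , ↭-refl
unique-⊆⇒complement {xs = x ∷ xs} (x∉xs ∷ xs!) sub with ∈-∃++ (sub (here refl))
... | us , vs , refl = proj₁ rest ,
      ↭-trans (shift x us vs) (↭-prep x (proj₂ rest))
  where
  remove : ∀ {y} → ¬ x ≡ y → y ∈ us ++ x ∷ vs → y ∈ us ++ vs
  remove x≢y y∈ with ∈-++⁻ us y∈
  ... | inj₁ y∈us         = ∈-++⁺ˡ y∈us
  ... | inj₂ (here y≡x)   = contradiction (sym y≡x) x≢y
  ... | inj₂ (there y∈vs) = ∈-++⁺ʳ us y∈vs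

  rest = unique-⊆⇒complement {ys = us ++ vs} xs!
    (λ y∈xs → remove (All.lookup x∉xs y∈xs) (sub (there y∈xs)))

length-mono-⊆ : ∀ {xs ys : List A} → Unique xs → xs ⊆ ys → length xs ≤ length ys
length-mono-⊆ {xs = xs} xs! sub with unique-⊆⇒complement xs! sub
... | zs , ys↭ rewrite ↭-length ys↭ | List.length-++ xs {zs} = ℕ.m≤m+n (length xs) (length zs)

unique-⊆⇒↭ : ∀ {xs ys : List A} → Unique xs → xs ⊆ ys → length xs ≡ length ys → ys ↭ xs
unique-⊆⇒↭ {xs = xs} xs! sub eq with unique-⊆⇒complement xs! sub
... | []     , ys↭ = subst (_ ↭_) (List.++-identityʳ xs) ys↭
... | z ∷ zs , ys↭ = contradiction
  (ℕ.+-cancelˡ-≡ (length xs) 0 (suc (length zs))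
    (trans (ℕ.+-identityʳ _) (trans eq (trans (↭-length ys↭) (List.length-++ xs)))))
  λ ()

-- A duplicate-free enumeration rather than a cardinality of a Sigma type: only the truth of `P w`
-- counts, not how many proofs it has. Two enumerations of one predicate then yield an equation
-- between numbers.
HasSize : (A → Set) → ℕ → Set
HasSize {A} P c = Σ[ xs ∈ List A ] Unique xs × (∀ {w} → w ∈ xs ⇔ P w) × length xs ≡ c

size-unique : ∀ {P : A → Set} {a b} → HasSize P a → HasSize P b → a ≡ b
size-unique (xs , xs! , xs⇔ , refl) (ys , ys! , ys⇔ , refl) = ℕ.≤-antisym
  (length-mono-⊆ xs! (from ys⇔ ∘ to xs⇔))
  (length-mono-⊆ ys! (from xs⇔ ∘ to ys⇔))

size-resp-⇔ : ∀ {P Q : A → Set} {c} → (∀ {w} → P w ⇔ Q w) → HasSize P c → HasSize Q c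
size-resp-⇔ P⇔Q (xs , xs! , xs⇔ , eq) =
  xs , xs! , mk⇔ (to P⇔Q ∘ to xs⇔) (from xs⇔ ∘ from P⇔Q) , eq

size-empty : ∀ {P : A → Set} → (∀ {w} → ¬ P w) → HasSize P 0
size-empty ¬P = [] , [] , mk⇔ (λ ()) (λ p → contradiction p ¬P) , refl

size-singleton : ∀ {P : A → Set} {v} → (∀ {w} → P w ⇔ w ≡ v) → HasSize P 1
size-singleton {v = v} P⇔ = (v ∷ []) , [] ∷ [] ,
  mk⇔ (λ { (here w≡v) → from P⇔ w≡v ; (there ()) }) (here ∘ to P⇔) , refl

size-⊎ : ∀ {P Q : A → Set} {a b} → (∀ {w} → P w → ¬ Q w) →
         HasSize P a → HasSize Q b → HasSize (λ w → P w ⊎ Q w) (a ℕ.+ b)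
size-⊎ disjoint (xs , xs! , xs⇔ , refl) (ys , ys! , ys⇔ , refl) =
  xs ++ ys ,
  Unique.++⁺ xs! ys! (λ (w∈xs , w∈ys) → disjoint (to xs⇔ w∈xs) (to ys⇔ w∈ys)) ,
  mk⇔ (Sum.map (to xs⇔) (to ys⇔) ∘ ∈-++⁻ xs)
      [ ∈-++⁺ˡ ∘ from xs⇔ , ∈-++⁺ʳ xs ∘ from ys⇔ ]′ ,
  List.length-++ xs

size-image : ∀ {P : A → Set} {c} (f : A → B) → (∀ {v w} → f v ≡ f w → v ≡ w) →
             HasSize P c → HasSize (λ w → ∃[ v ] P v × w ≡ f v) c
size-image f inj (xs , xs! , xs⇔ , refl) =
  map f xs , Unique.map⁺ inj xs! ,
  mk⇔ (λ w∈ → let v , v∈ , eq = ∈-map⁻ f w∈ in v , to xs⇔ v∈ , eq)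
      (λ { (v , Pv , refl) → ∈-map⁺ f (from xs⇔ Pv) }) ,
  List.length-map f xs

-- binomialTransform g n = Σᵢ (n choose i) g i, unfolded by Pascal's rule.
binomialTransform : (ℕ → ℕ) → ℕ → ℕ
binomialTransform g zero    = g zero
binomialTransform g (suc n) = binomialTransform (g ∘ suc) n ℕ.+ binomialTransform g n

-- Splitting a list into two interleaved sublists

⊆-interleavingˡ : ∀ {xs ys zs : List A} → Interleaving xs ys zs → xs ⊆ zs
⊆-interleavingˡ sp x∈xs = ∈-resp-↭ (↭-sym (toPermutation sp)) (∈-++⁺ˡ x∈xs)

⊆-interleavingʳ : ∀ {xs ys zs : List A} → Interleaving xs ys zs → ys ⊆ zs
⊆-interleavingʳ {xs = xs} sp y∈ys = ∈-resp-↭ (↭-sym (toPermutation sp)) (∈-++⁺ʳ xs y∈ys)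

-- The head of `zs` goes either left, which shifts `g`, or right, which leaves it alone; this is the
-- recursion of `binomialTransform`. Overlaps are excluded because `w` determines the left part.
size-interleavings : ∀ {zs : List A} {P : List A → List A → B → Set} {g} → Unique zs →
  (∀ {xs ys} → Interleaving xs ys zs → HasSize (P xs ys) (g (length xs))) →
  (∀ {xs ys xs′ ys′ w} → Interleaving xs ys zs → Interleaving xs′ ys′ zs →
     P xs ys w → P xs′ ys′ w → xs ≡ xs′) →
  HasSize (λ w → ∃[ xs ] ∃[ ys ] Interleaving xs ys zs × P xs ys w)
          (binomialTransform g (length zs))
size-interleavings {zs = []} _ size _ =
  size-resp-⇔ (mk⇔ (λ p → [] , [] , [] , p) λ { ([] , [] , [] , p) → p }) (size [])
size-interleavings {A = A} {B = B} {zs = z ∷ zs} {P} {g} (z∉zs ∷ zs!) size disjoint =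
  size-resp-⇔ (mk⇔ join split)
    (size-⊎ apart
      (size-interleavings {P = λ xs → P (z ∷ xs)} {g ∘ suc} zs! (size ∘ consˡ)
        λ sp sp′ p p′ → List.∷-injectiveʳ (disjoint (consˡ sp) (consˡ sp′) p p′))
      (size-interleavings {P = λ xs ys → P xs (z ∷ ys)} {g} zs! (size ∘ consʳ)
        λ sp sp′ → disjoint (consʳ sp) (consʳ sp′)))
  where
  Left Right : B → Set
  Left  w = ∃[ xs ] ∃[ ys ] Interleaving xs ys zs × P (z ∷ xs) ys w
  Right w = ∃[ xs ] ∃[ ys ] Interleaving xs ys zs × P xs (z ∷ ys) w

  join : ∀ {w} → Left w ⊎ Right w → ∃[ xs ] ∃[ ys ] Interleaving xs ys (z ∷ zs) × P xs ys w
  join (inj₁ (xs , ys , sp , p)) = z ∷ xs , ys , consˡ sp , p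
  join (inj₂ (xs , ys , sp , p)) = xs , z ∷ ys , consʳ sp , p

  split : ∀ {w} → ∃[ xs ] ∃[ ys ] Interleaving xs ys (z ∷ zs) × P xs ys w → Left w ⊎ Right w
  split (z ∷ xs , ys , consˡ sp , p) = inj₁ (xs , ys , sp , p)
  split (xs , z ∷ ys , consʳ sp , p) = inj₂ (xs , ys , sp , p)

  apart : ∀ {w} → Left w → ¬ Right w
  apart (xs , ys , sp , p) (xs′ , ys′ , sp′ , p′) with disjoint (consˡ sp) (consʳ sp′) p p′
  -- The left part of the second splitting would start with `z`, although it is drawn from `zs`
  -- alone.
  ... | refl = All.lookup z∉zs (⊆-interleavingˡ sp′ (here refl)) refl

-- Deletes the letters of `zs` one by one from whichever of `us` and `vs` holds them. The resulting
-- `xs` and `ys` keep the order of `zs`, and so stand for the letter sets of `us` and `vs`.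
↭-interleaving : ∀ (us vs : List A) {zs} → us ++ vs ↭ zs →
                 ∃[ xs ] ∃[ ys ] Interleaving xs ys zs × us ↭ xs × vs ↭ ys
↭-interleaving us vs {[]} p with us | vs | ↭-empty-inv p
... | [] | [] | refl = [] , [] , [] , ↭-refl , ↭-refl
↭-interleaving us vs {z ∷ zs} p with ∈-++⁻ us (∈-resp-↭ (↭-sym p) (here refl))
... | inj₁ z∈us with us₁ , us₂ , refl ← ∈-∃++ z∈us =
  let xs , ys , sp , us↭ , vs↭ = ↭-interleaving (us₁ ++ us₂) vs
        (subst (_↭ zs) (sym (List.++-assoc us₁ us₂ vs))
          (drop-mid us₁ [] (subst (_↭ z ∷ zs) (List.++-assoc us₁ (z ∷ us₂) vs) p)))
  in z ∷ xs , ys , consˡ sp , ↭-trans (shift z us₁ us₂) (↭-prep z us↭) , vs↭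
... | inj₂ z∈vs with vs₁ , vs₂ , refl ← ∈-∃++ z∈vs =
  let xs , ys , sp , us↭ , vs↭ = ↭-interleaving us (vs₁ ++ vs₂)
        (subst (_↭ zs) (List.++-assoc us vs₁ vs₂)
          (drop-mid (us ++ vs₁) [] (subst (_↭ z ∷ zs) (sym (List.++-assoc us vs₁ (z ∷ vs₂))) p)))
  in xs , z ∷ ys , consʳ sp , us↭ , ↭-trans (shift z vs₁ vs₂) (↭-prep z vs↭)

module _ {R : Rel A 0ℓ} where

  AllPairs-interleavingˡ : ∀ {xs ys zs} → Interleaving xs ys zs → AllPairs R zs → AllPairs R xs
  AllPairs-interleavingˡ [] [] = []
  AllPairs-interleavingˡ (consˡ sp) (z ∷ zs) =
    All.anti-mono (⊆-interleavingˡ sp) z ∷ AllPairs-interleavingˡ sp zs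
  AllPairs-interleavingˡ (consʳ sp) (z ∷ zs) = AllPairs-interleavingˡ sp zs

-- Arrangements around the least letter

-- Beginning with (d + 1) d ⋯ 1, for d = 0 including the convention on the empty word.
DescendsFor : ℕ → List (Fin k) → Set
DescendsFor zero    _            = ⊤
DescendsFor (suc d) (a ∷ b ∷ w) = b Fin.< a × DescendsFor d (b ∷ w)
DescendsFor (suc d) _            = ⊥

DescendsFor⇒< : ∀ d {w : List (Fin k)} → DescendsFor (suc d) w → suc d < length w
DescendsFor⇒< zero    {_ ∷ _ ∷ _} _       = s<s z<s
DescendsFor⇒< (suc d) {_ ∷ _ ∷ _} (_ , p) = s<s (DescendsFor⇒< d p)

-- Both prefixes end just before the first occurrence of `m`.
++∷-cancelˡ : ∀ (us us′ : List A) {m vs vs′} → ¬ m ∈ us → ¬ m ∈ us′ →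
              us ++ m ∷ vs ≡ us′ ++ m ∷ vs′ → us ≡ us′
++∷-cancelˡ [] [] _ _ _ = refl
++∷-cancelˡ [] (u ∷ us′) _ m∉ eq = contradiction (here (List.∷-injectiveˡ eq)) m∉
++∷-cancelˡ (u ∷ us) [] m∉ _ eq = contradiction (here (sym (List.∷-injectiveˡ eq))) m∉
++∷-cancelˡ (u ∷ us) (u′ ∷ us′) m∉ m∉′ eq = cong₂ _∷_ (List.∷-injectiveˡ eq)
  (++∷-cancelˡ us us′ (m∉ ∘ there) (m∉′ ∘ there) (List.∷-injectiveʳ eq))

module _ {m : Fin k} where

  -- No descent can start at `m`. The initial run of descents therefore lies inside `us`, or its
  -- last descent is the step into `m`, and then `us` is exactly the decreasing run before it.
  DescendsFor-++∷⁻ : ∀ d (us : List (Fin k)) {vs} → All (m Fin.<_) vs →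
    DescendsFor (suc d) (us ++ m ∷ vs) →
    DescendsFor (suc d) us ⊎ (length us ≡ suc d × AllPairs Fin._>_ us)
  DescendsFor-++∷⁻ d [] (m<v ∷ _) (v<m , _) = contradiction v<m (Fin.<-asym m<v)
  DescendsFor-++∷⁻ zero (u ∷ []) m<vs _ = inj₂ (refl , [] ∷ [])
  DescendsFor-++∷⁻ zero (u ∷ u′ ∷ us) m<vs (u′<u , _) = inj₁ (u′<u , tt)
  -- A further descent would have to start at `m`, below which nothing follows.
  DescendsFor-++∷⁻ (suc d) (u ∷ []) m<vs (_ , p) with DescendsFor-++∷⁻ d [] m<vs p
  ... | inj₁ ()
  ... | inj₂ (() , _)
  DescendsFor-++∷⁻ (suc d) (u ∷ u′ ∷ us) m<vs (u′<u , p) with DescendsFor-++∷⁻ d (u′ ∷ us) m<vs p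
  ... | inj₁ q = inj₁ (u′<u , q)
  ... | inj₂ (eq , u′>us ∷ desc) = inj₂ (cong suc eq ,
    (u′<u ∷ All.map (λ x<u′ → Fin.<-trans x<u′ u′<u) u′>us) ∷ u′>us ∷ desc)

  DescendsFor-++∷⁺ : ∀ d {us vs : List (Fin k)} →
    DescendsFor d us → DescendsFor d (us ++ m ∷ vs)
  DescendsFor-++∷⁺ zero _ = tt
  DescendsFor-++∷⁺ (suc d) {_ ∷ _ ∷ _} (p , q) = p , DescendsFor-++∷⁺ d q

  DescendsFor-length-++∷ : ∀ {us vs : List (Fin k)} → All (m Fin.<_) us → AllPairs Fin._>_ us →
    DescendsFor (length us) (us ++ m ∷ vs)
  DescendsFor-length-++∷ [] [] = tt
  DescendsFor-length-++∷ {us = _ ∷ []} (m<u ∷ []) _ = m<u , tt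
  DescendsFor-length-++∷ {us = _ ∷ _ ∷ _} (_ ∷ m<us) ((u>u′ ∷ _) ∷ desc) =
    u>u′ , DescendsFor-length-++∷ m<us desc

module Avoidance (_⊑_ : Rel (Fin k) 0ℓ) where

  -- For 1-23 the order ⊑ is ≥, and for 1-32 it is ≤.
  SafeAfter : Fin k → Rel (Fin k) 0ℓ
  SafeAfter a b c = a Fin.< b → a Fin.< c → b ⊑ c

  Avoiding : List (Fin k) → Set
  Avoiding []      = ⊤
  Avoiding (a ∷ w) = Linked (SafeAfter a) w × Avoiding w

  sorted⇒Avoiding : ∀ {vs} → Linked _⊑_ vs → Avoiding vs
  sorted⇒Avoiding {[]} [] = tt
  sorted⇒Avoiding {v ∷ vs} p =
    Linked.map (λ b⊑c _ _ → b⊑c) (Linked.tail p) , sorted⇒Avoiding (Linked.tail p)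

  module _ {m : Fin k} where

    -- Every later letter exceeds `m`, so the two premises of `SafeAfter m` always hold on `vs` and
    -- only `b ⊑ c` remains.
    Avoiding-++∷⁻ : ∀ us {vs} → All (m Fin.<_) vs →
                    Avoiding (us ++ m ∷ vs) → Avoiding us × Linked _⊑_ vs
    Avoiding-++∷⁻ [] m<vs (p , _) = tt , strip m<vs p
      where
      strip : ∀ {vs} → All (m Fin.<_) vs → Linked (SafeAfter m) vs → Linked _⊑_ vs
      strip [] [] = []
      strip (_ ∷ []) [-] = [-]
      strip (m<v ∷ m<v′ ∷ m<vs) (s ∷ p) = s m<v m<v′ ∷ strip (m<v′ ∷ m<vs) p
    Avoiding-++∷⁻ (u ∷ us) m<vs (p , av) =
      let av′ , sorted = Avoiding-++∷⁻ us m<vs av in (prefix us p , av′) , sorted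
      where
      prefix : ∀ us {vs} → Linked (SafeAfter u) (us ++ vs) → Linked (SafeAfter u) us
      prefix [] _ = []
      prefix (_ ∷ []) _ = [-]
      prefix (_ ∷ us@(_ ∷ _)) (s ∷ p) = s ∷ prefix us p

    -- After a letter `u` of `us`, an adjacent pair containing `m` is safe because `m` is below `u`,
    -- and a pair inside `vs` is safe because it is sorted.
    Avoiding-++∷⁺ : ∀ {us vs} → All (m Fin.<_) us →
                    Avoiding us → Linked _⊑_ vs → Avoiding (us ++ m ∷ vs)
    Avoiding-++∷⁺ [] _ sorted =
      Linked.map (λ b⊑c _ _ → b⊑c) sorted , sorted⇒Avoiding sorted
    Avoiding-++∷⁺ {u ∷ us} {vs} (m<u ∷ m<us) (p , av) sorted =
      append p , Avoiding-++∷⁺ m<us av sorted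
      where
      afterMinimum : ∀ {vs} → Linked _⊑_ vs → Linked (SafeAfter u) (m ∷ vs)
      afterMinimum [] = [-]
      afterMinimum {_ ∷ _} sorted =
        (λ u<m _ → contradiction u<m (Fin.<-asym m<u)) ∷ Linked.map (λ b⊑c _ _ → b⊑c) sorted

      append : ∀ {us} → Linked (SafeAfter u) us → Linked (SafeAfter u) (us ++ m ∷ vs)
      append [] = afterMinimum sorted
      append [-] = (λ _ u<m → contradiction u<m (Fin.<-asym m<u)) ∷ afterMinimum sorted
      append (s ∷ p) = s ∷ append p

  -- An occurrence needs a letter followed by a larger one. This handles the prefixes that obtain
  -- their last descent from `m`.
  descending⇒Avoiding : ∀ {us} → AllPairs Fin._>_ us → Avoiding us
  descending⇒Avoiding [] = tt
  descending⇒Avoiding (u>us ∷ desc) = never u>us , descending⇒Avoiding desc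
    where
    never : ∀ {u us} → All (u Fin.>_) us → Linked (SafeAfter u) us
    never [] = []
    never (_ ∷ []) = [-]
    never (u>b ∷ rest@(_ ∷ _)) = (λ u<b → contradiction u<b (Fin.<-asym u>b)) ∷ never rest

-- Sorted lists as canonical representatives

module _ {_⊑_ : Rel A 0ℓ} (isDecTotalOrder : IsDecTotalOrder _≡_ _⊑_) where

  private
    order : DecTotalOrder 0ℓ 0ℓ 0ℓ
    order = record { isDecTotalOrder = isDecTotalOrder }

    module S = Sort order

  sorted-↭⇒≡ : ∀ {us vs : List A} → Linked _⊑_ us → Linked _⊑_ vs → us ↭ vs → us ≡ vs
  sorted-↭⇒≡ us↗ vs↗ us↭vs =
    Pointwise-≡⇒≡ (↗↭↗⇒≋ (DecTotalOrder.totalOrder order) us↗ vs↗ (↭⇒↭ₛ us↭vs))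

  sortBy : List A → List A
  sortBy = S.sort

  sortBy-↭ : ∀ us → sortBy us ↭ us
  sortBy-↭ = S.sort-↭

  sortBy-↗ : ∀ us → Linked _⊑_ (sortBy us)
  sortBy-↗ = S.sort-↗

  -- Turns sortedness into an explicit word: once their set is chosen, the letters after the least
  -- one leave no freedom.
  ↭-sortBy⇒≡ : ∀ {us vs} → Linked _⊑_ us → us ↭ vs → us ≡ sortBy vs
  ↭-sortBy⇒≡ {vs = vs} us↗ p = sorted-↭⇒≡ us↗ (sortBy-↗ vs) (↭-trans p (↭-sym (sortBy-↭ vs)))

kronecker : ℕ → ℕ → ℕ
kronecker zero    zero    = 1
kronecker zero    (suc _) = 0
kronecker (suc _) zero    = 0
kronecker (suc d) (suc i) = kronecker d i

kronecker-refl : ∀ d → kronecker d d ≡ 1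
kronecker-refl zero    = refl
kronecker-refl (suc d) = kronecker-refl d

kronecker-≢ : ∀ d i → i ≢ d → kronecker d i ≡ 0
kronecker-≢ zero    zero    i≢d = contradiction refl i≢d
kronecker-≢ zero    (suc i) i≢d = refl
kronecker-≢ (suc d) zero    i≢d = refl
kronecker-≢ (suc d) (suc i) i≢d = kronecker-≢ d i (i≢d ∘ cong suc)

-- One if the decreasing word on i letters gets its d-th descent from a smaller letter
-- appended to it, and zero otherwise.
completing : ℕ → ℕ → ℕ
completing zero    _ = 0
completing (suc d) i = kronecker (suc d) i

Increasing : List (Fin k) → Set
Increasing = AllPairs Fin._<_

increasing-↭⇒≡ : ∀ {us vs : List (Fin k)} → Increasing us → Increasing vs → us ↭ vs → us ≡ vs
increasing-↭⇒≡ us↗ vs↗ = sorted-↭⇒≡ Fin.≤-isDecTotalOrder (weaken us↗) (weaken vs↗)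
  where
  weaken : ∀ {us : List (Fin k)} → Increasing us → Linked Fin._≤_ us
  weaken = Linked.map ℕ.<⇒≤ ∘ Linked.AllPairs⇒Linked

increasing⇒unique : ∀ {us : List (Fin k)} → Increasing us → Unique us
increasing⇒unique = AllPairs.map Fin.<⇒≢

≥-isDecTotalOrder : IsDecTotalOrder {A = Fin k} _≡_ Fin._≥_
≥-isDecTotalOrder = Flip.isDecTotalOrder Fin.≤-isDecTotalOrder

sortBy-≥-descending : ∀ {us : List (Fin k)} → Unique us →
                      AllPairs Fin._>_ (sortBy ≥-isDecTotalOrder us)
sortBy-≥-descending {k} {us} us! = AllPairs.zipWith
  (λ (b≤a , a≢b) → Fin.≤∧≢⇒< b≤a (a≢b ∘ sym))
  (Linked.Linked⇒AllPairs (λ b≤a c≤b → Fin.≤-trans c≤b b≤a) (sortBy-↗ ≥-isDecTotalOrder us) ,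
   Permutationₛ.Unique-resp-↭ (setoid (Fin k)) (↭⇒↭ₛ (↭-sym (sortBy-↭ ≥-isDecTotalOrder us))) us!)

descending-↭⇒≡ : ∀ {us vs : List (Fin k)} → AllPairs Fin._>_ us → us ↭ vs →
                 us ≡ sortBy ≥-isDecTotalOrder vs
descending-↭⇒≡ us↘ = ↭-sortBy⇒≡ ≥-isDecTotalOrder
  (Linked.map ℕ.<⇒≤ (Linked.AllPairs⇒Linked us↘))

module Arrangements {_⊑_ : Rel (Fin k) 0ℓ} (isDecTotalOrder : IsDecTotalOrder _≡_ _⊑_) where

  open Avoidance _⊑_

  sort sort≥ : List (Fin k) → List (Fin k)
  sort  = sortBy isDecTotalOrder
  sort≥ = sortBy ≥-isDecTotalOrder

  -- The letters are an arbitrary list instead of the whole alphabet, so that the word before the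
  -- least letter is again covered.
  Arrangement : ℕ → List (Fin k) → List (Fin k) → Set
  Arrangement d us w = w ↭ us × Avoiding w × DescendsFor d w

  -- The clause `d ≢ 0` prevents double counting: with no descents demanded, the empty word is
  -- already an `Arrangement`.
  Completing : ℕ → List (Fin k) → List (Fin k) → Set
  Completing d us w = d ≢ 0 × length us ≡ d × w ≡ sort≥ us

  size-Completing : ∀ d us → HasSize (Completing d us) (completing d (length us))
  size-Completing zero us = size-empty λ (0≢0 , _) → 0≢0 refl
  size-Completing (suc d) us with length us ℕ.≟ suc d
  ... | yes eq rewrite eq | kronecker-refl d =
    size-singleton (mk⇔ (proj₂ ∘ proj₂) (λ w≡ → (λ ()) , refl , w≡))
  ... | no ≢ rewrite kronecker-≢ (suc d) (length us) ≢ = size-empty λ (_ , eq , _) → ≢ eq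

  Prefix : ℕ → List (Fin k) → List (Fin k) → Set
  Prefix d us w = Arrangement d us w ⊎ Completing d us w

  -- The least letter m forces the letters ys after it to be sorted, while those
  -- before it have their d descents already or get the last one from m.
  Split : ℕ → Fin k → List (Fin k) → List (Fin k) → List (Fin k) → Set
  Split d m xs ys w = ∃[ u ] Prefix d xs u × w ≡ u ++ m ∷ sort ys

  module _ (d : ℕ) {m : Fin k} {zs : List (Fin k)} (m<zs : All (m Fin.<_) zs) where

    private
      after-m : ∀ {us xs} → us ↭ xs → (∀ {x} → x ∈ xs → x ∈ zs) → All (m Fin.<_) us
      after-m us↭xs xs⊆zs = All.tabulate (All.lookup m<zs ∘ xs⊆zs ∘ ∈-resp-↭ us↭xs)

      m∉ : ∀ {us} → All (m Fin.<_) us → ¬ m ∈ us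
      m∉ m<us m∈us = Fin.<-irrefl refl (All.lookup m<us m∈us)

    Prefix-↭ : ∀ {xs u} → Prefix d xs u → u ↭ xs
    Prefix-↭ (inj₁ (u↭xs , _)) = u↭xs
    Prefix-↭ {xs} (inj₂ (_ , _ , refl)) = sortBy-↭ ≥-isDecTotalOrder xs

    Arrangement⇒Split : ∀ {w} → Arrangement d (m ∷ zs) w →
      ∃[ xs ] ∃[ ys ] Interleaving xs ys zs × Split d m xs ys w
    Arrangement⇒Split (w↭ , avoiding , descends)
      with us , vs , refl ← ∈-∃++ (∈-resp-↭ (↭-sym w↭) (here refl))
      with xs , ys , sp , us↭ , vs↭ ← ↭-interleaving us vs (drop-mid us [] w↭)
      with m<vs ← after-m vs↭ (⊆-interleavingʳ sp)
      with avoiding-us , vs↗ ← Avoiding-++∷⁻ us m<vs avoiding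
      with refl ← ↭-sortBy⇒≡ isDecTotalOrder vs↗ vs↭
      = xs , ys , sp , us , prefix d descends , refl
      where
      prefix : ∀ d → DescendsFor d (us ++ m ∷ sort ys) → Prefix d xs us
      prefix zero    _ = inj₁ (us↭ , avoiding-us , tt)
      prefix (suc d) p with DescendsFor-++∷⁻ d us m<vs p
      ... | inj₁ q           = inj₁ (us↭ , avoiding-us , q)
      ... | inj₂ (eq , desc) =
        inj₂ ((λ ()) , trans (sym (↭-length us↭)) eq , descending-↭⇒≡ desc us↭)

    Split⇒Arrangement : ∀ {xs ys w} → Increasing zs → Interleaving xs ys zs →
      Split d m xs ys w → Arrangement d (m ∷ zs) w
    Split⇒Arrangement {xs} {ys} zs↗ sp (u , prefix , refl) =
      ↭-trans (shift m u (sort ys)) (↭-prep m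
        (↭-trans (++⁺ u↭xs (sortBy-↭ isDecTotalOrder ys)) (↭-sym (toPermutation sp)))) ,
      Avoiding-++∷⁺ m<u (avoiding prefix) (sortBy-↗ isDecTotalOrder ys) ,
      descends d prefix
      where
      u↭xs = Prefix-↭ prefix
      m<u  = after-m u↭xs (⊆-interleavingˡ sp)

      xs-descending : AllPairs Fin._>_ (sort≥ xs)
      xs-descending = sortBy-≥-descending
        (increasing⇒unique (AllPairs-interleavingˡ sp zs↗))

      avoiding : Prefix d xs u → Avoiding u
      avoiding (inj₁ (_ , av , _)) = av
      avoiding (inj₂ (_ , _ , refl)) = descending⇒Avoiding xs-descending

      descends : ∀ d → Prefix d xs u → DescendsFor d (u ++ m ∷ sort ys)
      descends zero    _ = tt
      descends (suc d) (inj₁ (_ , _ , desc)) = DescendsFor-++∷⁺ (suc d) desc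
      descends (suc d) (inj₂ (_ , eq , refl)) =
        subst (λ d → DescendsFor d (sort≥ xs ++ m ∷ sort ys))
        (trans (↭-length u↭xs) eq) (DescendsFor-length-++∷ m<u xs-descending)

    -- A word with `d` descents of its own, `d` positive, has more than `d` letters, whereas a
    -- completing prefix has exactly `d`.
    Prefix-disjoint : ∀ {xs w} → Arrangement d xs w → ¬ Completing d xs w
    Prefix-disjoint = disjoint d
      where
      disjoint : ∀ d {xs w} → Arrangement d xs w → ¬ Completing d xs w
      disjoint zero    _                  (0≢0 , _)      = 0≢0 refl
      disjoint (suc d) (w↭xs , _ , desc) (_ , eq , _) =
        ℕ.<-irrefl (sym (trans (↭-length w↭xs) eq)) (DescendsFor⇒< d desc)

    -- The result depends on `zs` only through its length. The length bound on the assumed sizes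
    -- makes the lemma usable as a step of strong induction.
    size-Arrangement-∷ : Increasing zs → (g : ℕ → ℕ) →
      (∀ {xs} → Increasing xs → length xs ≤ length zs →
         HasSize (Arrangement d xs) (g (length xs))) →
      HasSize (Arrangement d (m ∷ zs))
              (binomialTransform (λ i → g i ℕ.+ completing d i) (length zs))
    size-Arrangement-∷ zs↗ g size = size-resp-⇔
      (mk⇔ (λ (_ , _ , sp , split) → Split⇒Arrangement zs↗ sp split) Arrangement⇒Split)
      (size-interleavings (increasing⇒unique zs↗)
        (λ {xs} {ys} sp → size-image (_++ m ∷ sort ys)
          (λ {v} {w} → List.++-cancelʳ (m ∷ sort ys) v w)
          (size-⊎ Prefix-disjoint
            (size (AllPairs-interleavingˡ sp zs↗)
              (length-mono-⊆ (increasing⇒unique (AllPairs-interleavingˡ sp zs↗)) (⊆-interleavingˡ sp)))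
            (size-Completing d xs)))
        -- The word determines `xs`: cutting at `m` recovers the prefix, and an increasing list is
        -- fixed by its letters.
        λ { sp sp′ (u , p , refl) (u′ , p′ , eq) →
          increasing-↭⇒≡ (AllPairs-interleavingˡ sp zs↗) (AllPairs-interleavingˡ sp′ zs↗)
            (↭-trans (↭-sym (Prefix-↭ p)) (subst (_↭ _) (sym
              (++∷-cancelˡ u u′
                (m∉ (after-m (Prefix-↭ p) (⊆-interleavingˡ sp)))
                (m∉ (after-m (Prefix-↭ p′) (⊆-interleavingˡ sp′))) eq)) (Prefix-↭ p′))) })

-- Permutations as arrangements

toList-inj : ∀ {n} {u v : Vec A n} → toList u ≡ toList v → u ≡ v
toList-inj {u = []} {[]} _ = refl
toList-inj {u = _ ∷ _} {_ ∷ _} eq =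
  cong₂ _∷_ (List.∷-injectiveˡ eq) (toList-inj (List.∷-injectiveʳ eq))

toList-surjective : ∀ (w : List A) {n} → length w ≡ n → Σ[ v ∈ Vec A n ] w ≡ toList v
toList-surjective w refl = fromList w , sym (Vec.toList∘fromList w)

module _ {R : Rel A 0ℓ} where

  AllPairs-toList : ∀ {n} (v : Vec A n) → Vec.AllPairs R v ⇔ AllPairs R (toList v)
  AllPairs-toList [] = mk⇔ (λ _ → []) (λ _ → Vec.[])
  AllPairs-toList (a ∷ v) = mk⇔
    (λ { (p Vec.∷ ps) → VecAll.toList⁺ p ∷ to (AllPairs-toList v) ps })
    (λ { (p ∷ ps) → VecAll.toList⁻ p Vec.∷ from (AllPairs-toList v) ps })

  Linked-toList : ∀ {n} (v : Vec A n) →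
    (∀ j j′ → toℕ j′ ≡ suc (toℕ j) → R (lookup v j) (lookup v j′)) ⇔ Linked R (toList v)
  Linked-toList v = mk⇔ (linked v) (λ p j j′ → consecutive p j j′)
    where
    linked : ∀ {n} (v : Vec A n) →
      (∀ j j′ → toℕ j′ ≡ suc (toℕ j) → R (lookup v j) (lookup v j′)) → Linked R (toList v)
    linked [] _ = []
    linked (_ ∷ []) _ = [-]
    linked (_ ∷ v@(_ ∷ _)) r =
      r 0F (sucF 0F) refl ∷ linked v (λ j j′ eq → r (sucF j) (sucF j′) (cong suc eq))

    consecutive : ∀ {n} {v : Vec A n} → Linked R (toList v) →
      ∀ j j′ → toℕ j′ ≡ suc (toℕ j) → R (lookup v j) (lookup v j′)
    consecutive {v = _ ∷ _ ∷ _} (r ∷ _) 0F (sucF 0F) _ = r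
    consecutive {v = _ ∷ _ ∷ _} (_ ∷ p) (sucF j) (sucF j′) eq =
      consecutive p j j′ (ℕ.suc-injective eq)

AllPairs>-lookup : ∀ {n} {u : Vec ℕ n} → Vec.AllPairs _>_ u →
                   ∀ i j → lookup u i < lookup u j ⇔ j Fin.< i
AllPairs>-lookup {u = a ∷ u} (a>u Vec.∷ _) 0F 0F =
  mk⇔ (λ a<a → contradiction a<a (ℕ.<-irrefl refl)) λ ()
AllPairs>-lookup {u = a ∷ u} (a>u Vec.∷ _) 0F (sucF j) =
  mk⇔ (λ a<u → contradiction a<u (ℕ.<-asym (VecAll.lookup⁺ a>u j))) λ ()
AllPairs>-lookup {u = a ∷ u} (a>u Vec.∷ _) (sucF i) 0F =
  mk⇔ (λ _ → z<s) (λ _ → VecAll.lookup⁺ a>u i)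
AllPairs>-lookup {u = a ∷ u} (_ Vec.∷ ps) (sucF i) (sucF j) =
  mk⇔ (s<s ∘ to (AllPairs>-lookup ps i j)) (from (AllPairs>-lookup ps i j) ∘ s<s⁻¹)

lookup⇒AllPairs> : ∀ {n} {u : Vec ℕ n} → (∀ i j → j Fin.< i → lookup u i < lookup u j) →
                   Vec.AllPairs _>_ u
lookup⇒AllPairs> {u = []} _ = Vec.[]
lookup⇒AllPairs> {u = a ∷ u} f =
  VecAll.lookup⁻ (λ i → f (sucF i) 0F z<s) Vec.∷
  lookup⇒AllPairs> (λ i j → f (sucF i) (sucF j) ∘ s<s)

descending-AllPairs> : ∀ k → Vec.AllPairs _>_ (descending k)
descending-AllPairs> zero = Vec.[]
descending-AllPairs> (suc k) = bound k ℕ.≤-refl Vec.∷ descending-AllPairs> k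
  where
  bound : ∀ {l} k → k ≤ l → Vec.All (suc l >_) (descending k)
  bound zero _ = Vec.[]
  bound (suc k) k<l = s<s k<l Vec.∷ bound k (ℕ.<⇒≤ k<l)

-- In a strictly decreasing vector the comparison of two entries is the reversed comparison of their
-- positions, hence the same for all such vectors of one length.
orderIsomorphic-descending : (u : Vec ℕ k) → OrderIsomorphic u (descending k) ⇔ Vec.AllPairs _>_ u
orderIsomorphic-descending {k} u = mk⇔
  (λ iso → lookup⇒AllPairs> λ i j →
    from (iso i j) ∘ from (AllPairs>-lookup (descending-AllPairs> k) i j))
  (λ u> i j → mk⇔
    (from (AllPairs>-lookup (descending-AllPairs> k) i j) ∘ to (AllPairs>-lookup u> i j))
    (from (AllPairs>-lookup u> i j) ∘ to (AllPairs>-lookup (descending-AllPairs> k) i j)))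

truncate⇒DescendsFor : ∀ d (v : Vec (Fin k) n) (d<n : suc d ≤ n) →
  Vec.AllPairs _>_ (truncate d<n (Vec.map toℕ v)) → DescendsFor d (toList v)
truncate⇒DescendsFor zero v _ _ = tt
truncate⇒DescendsFor (suc d) (a ∷ b ∷ v) (s≤s (s≤s d<n)) ((a>b Vec.∷ _) Vec.∷ ps) =
  a>b , truncate⇒DescendsFor d (b ∷ v) (s≤s d<n) ps

DescendsFor⇒truncate : ∀ d (v : Vec (Fin k) n) (d<n : suc d ≤ n) →
  DescendsFor d (toList v) → Vec.AllPairs _>_ (truncate d<n (Vec.map toℕ v))
DescendsFor⇒truncate zero (a ∷ v) (s≤s z≤n) _ = Vec.[] Vec.∷ Vec.[]
DescendsFor⇒truncate (suc d) (a ∷ b ∷ v) (s≤s (s≤s d<n)) (b<a , p)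
  with DescendsFor⇒truncate d (b ∷ v) (s≤s d<n) p
... | b> Vec.∷ ps = (b<a Vec.∷ Vec.map-All (λ b>c → ℕ.<-trans b>c b<a) b>) Vec.∷ b> Vec.∷ ps

BeginsWith-descending : ∀ d (π : Word n) →
  BeginsWith (descending (suc d)) π ⇔ DescendsFor d (toList π)
BeginsWith-descending {n} d π = mk⇔ descends (begins d π)
  where
  descends : BeginsWith (descending (suc d)) π → DescendsFor d (toList π)
  descends (inj₁ (d<n , iso)) =
    truncate⇒DescendsFor d π d<n (to (orderIsomorphic-descending _) iso)
  descends (inj₂ (_ , refl)) = tt

  begins : ∀ {n} d (π : Word n) → DescendsFor d (toList π) → BeginsWith (descending (suc d)) π
  -- The empty word begins with the one-letter pattern only by convention.
  begins zero [] _ = inj₂ (refl , refl)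
  begins {suc n} zero π p = inj₁ (s≤s z≤n ,
    from (orderIsomorphic-descending _) (DescendsFor⇒truncate 0 π (s≤s z≤n) p))
  begins {n} (suc d) π p = inj₁ (d<n ,
    from (orderIsomorphic-descending _) (DescendsFor⇒truncate (suc d) π d<n p))
    where
    d<n : suc d < n
    d<n = subst (suc d <_) (Vec.length-toList π) (DescendsFor⇒< d p)

∈-words : ∀ {as : List A} → (∀ a → a ∈ as) → ∀ {n} (v : Vec A n) → v ∈ words as n
∈-words all []      = here refl
∈-words all (a ∷ v) = ∈-cartesianProductWith⁺ _∷_ (all a) (∈-words all v)

words-unique : ∀ {as : List A} → Unique as → ∀ n → Unique (words as n)
words-unique as! zero    = [] ∷ []
words-unique as! (suc n) =
  Unique.cartesianProductWith⁺ _∷_ Vec.∷-injective as! (words-unique as! n)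

allFin-increasing : ∀ n → Increasing (allFin n)
allFin-increasing n = AllPairs.tabulate⁺-< (λ i<j → i<j)

-- Pigeonhole principle: n distinct letters exhaust an alphabet of n letters.
unique⇔↭-allFin : (π : Word n) → Vec.Unique π ⇔ (toList π ↭ allFin n)
unique⇔↭-allFin {n} π = mk⇔
  (λ π! → ↭-sym (unique-⊆⇒↭ (to (AllPairs-toList π) π!) (λ {i} _ → ∈-allFin i)
     (trans (Vec.length-toList π) (sym (List.length-tabulate (λ i → i))))))
  (λ π↭ → from (AllPairs-toList π)
     (Permutationₛ.Unique-resp-↭ (setoid (Fin n)) (↭⇒↭ₛ (↭-sym π↭))
       (increasing⇒unique (allFin-increasing n))))

-- `matches` is the interface to the pattern: the first letter is the least, and the other two
-- violate `⊑`.
module Permutations (q : Vec ℕ 3)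
  (_⊑_ : ∀ {k} → Rel (Fin k) 0ℓ)
  (isDecTotalOrder : ∀ {k} → IsDecTotalOrder _≡_ (_⊑_ {k}))
  (matches : ∀ {k} (a b c : Fin k) →
     OrderIsomorphic (toℕ a ∷ toℕ b ∷ toℕ c ∷ []) q ⇔ (a Fin.< b × a Fin.< c × ¬ b ⊑ c))
  where

  module _ {k : ℕ} where
    open Avoidance (_⊑_ {k}) public
    open Arrangements (isDecTotalOrder {k}) public

  Avoiding-toList : (v : Vec (Fin k) n) →
    (∀ i j j′ → i Fin.< j → toℕ j′ ≡ suc (toℕ j) →
       SafeAfter (lookup v i) (lookup v j) (lookup v j′)) ⇔ Avoiding (toList v)
  Avoiding-toList [] = mk⇔ (λ _ → tt) (λ _ ())
  Avoiding-toList (a ∷ v) = mk⇔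
    (λ safe → to (Linked-toList v) (λ j j′ eq → safe 0F (sucF j) (sucF j′) z<s (cong suc eq)) ,
              to (Avoiding-toList v) (λ i j j′ i<j eq →
                safe (sucF i) (sucF j) (sucF j′) (s<s i<j) (cong suc eq)))
    λ { (p , _) 0F (sucF j) (sucF j′) _ eq → from (Linked-toList v) p j j′ (ℕ.suc-injective eq)
      ; (_ , p) (sucF i) (sucF j) (sucF j′) i<j eq →
          from (Avoiding-toList v) p i j j′ (s<s⁻¹ i<j) (ℕ.suc-injective eq) }

  Avoids⇔Avoiding : (π : Word n) → Avoids q π ⇔ Avoiding (toList π)
  Avoids⇔Avoiding π = mk⇔
    (λ avoids → to (Avoiding-toList π) λ i j j′ i<j eq a<b a<c →
      -- Avoidance refutes only the negation of `b ⊑ c`; decidability of the order gives the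
      -- relation itself.
      decidable-stable (IsDecTotalOrder._≤?_ isDecTotalOrder _ _)
        λ b⋢c → avoids (i , j , j′ , i<j , eq , from (matches _ _ _) (a<b , a<c , b⋢c)))
    (λ avoiding (i , j , j′ , i<j , eq , iso) →
      let a<b , a<c , b⋢c = to (matches _ _ _) iso
      in b⋢c (from (Avoiding-toList π) avoiding i j j′ i<j eq a<b a<c))

  module Recurrence (d : ℕ) (count : ℕ → ℕ)
    (size-allFin : ∀ n → HasSize (Arrangement d (allFin n)) (count n)) where

    size-[] : HasSize (Arrangement {k} d []) (kronecker d 0)
    size-[] = size d
      where
      size : ∀ d → HasSize (Arrangement {k} d []) (kronecker d 0)
      size zero    = size-singleton (mk⇔ (λ (w↭ , _) → ↭-empty-inv w↭)
        (λ { refl → ↭-refl , tt , tt }))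
      size (suc d) = size-empty λ (w↭ , _ , desc) →
        contradiction (subst (suc d <_) (↭-length w↭) (DescendsFor⇒< d desc)) λ ()

    count-zero : count 0 ≡ kronecker d 0
    count-zero = size-unique (size-allFin 0) size-[]

    SizesUpTo : ℕ → Set
    SizesUpTo n = ∀ {k} {us : List (Fin k)} → Increasing us → length us ≤ n →
                  HasSize (Arrangement d us) (count (length us))

    size-suc : ∀ {n} → SizesUpTo n → ∀ {k} {us : List (Fin k)} → Increasing us → length us ≡ suc n →
               HasSize (Arrangement d us) (binomialTransform (λ i → count i ℕ.+ completing d i) n)
    size-suc sizes {us = u ∷ us} (u<us ∷ us↗) refl = size-Arrangement-∷ d u<us us↗ count sizes

    -- No standardization of words is needed: the recurrence gives the same number for
    -- all alphabets of suc n letters, and for allFin (suc n) that number is the count.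
    count-suc′ : ∀ {n} → SizesUpTo n →
                 count (suc n) ≡ binomialTransform (λ i → count i ℕ.+ completing d i) n
    count-suc′ {n} sizes = size-unique (size-allFin (suc n))
      (size-suc sizes (allFin-increasing (suc n)) (List.length-tabulate (λ i → i)))

    -- Strong induction on the length: the prefixes before the least letter are no longer than the
    -- tail, and `count-suc′` rewrites the resulting transform as `count`.
    sizesUpTo : ∀ n → SizesUpTo n
    sizesUpTo n {us = []} _ _ = subst (HasSize _) (sym count-zero) size-[]
    sizesUpTo (suc n) {us = u ∷ us} us↗ (s≤s us≤n) = subst (HasSize _) (sym (count-suc′ sizes))
      (size-suc sizes us↗ refl)
      where
      sizes : SizesUpTo (length us)
      sizes {us = vs} vs↗ vs≤us = sizesUpTo n {us = vs} vs↗ (ℕ.≤-trans vs≤us us≤n)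

    count-suc : ∀ n → count (suc n) ≡ binomialTransform (λ i → count i ℕ.+ completing d i) n
    count-suc n = count-suc′ (sizesUpTo n)

  module _ (d : ℕ) where

    -- The filtered list whose length defines `N` serves as the enumeration, transported along the
    -- injection `toList`.
    size-allFin : ∀ n → HasSize (Arrangement d (allFin n)) (N (descending (suc d)) q n)
    size-allFin n = size-resp-⇔ (mk⇔ arrangement word)
      (size-image toList toList-inj
        (filter good? (permutations n) ,
         Unique.filter⁺ good? (Unique.filter⁺ unique?
           (words-unique (increasing⇒unique (allFin-increasing n)) n)) ,
         mk⇔ (λ π∈ → let π∈perms , avoids , begins = ∈-filter⁻ good? π∈
                     in proj₂ (∈-filter⁻ unique? {xs = words (allFin n) n} π∈perms) ,
                        avoids , begins)
             (λ (π! , good) → ∈-filter⁺ good? (∈-filter⁺ unique? (∈-words ∈-allFin _) π!) good) ,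
         refl))
      where
      good? = λ (π : Word n) → avoids? q π ×-dec beginsWith? (descending (suc d)) π

      Good : Word n → Set
      Good π = Vec.Unique π × Avoids q π × BeginsWith (descending (suc d)) π

      arrangement : ∀ {w} → ∃[ π ] Good π × w ≡ toList π → Arrangement d (allFin n) w
      arrangement (π , (π! , avoids , begins) , refl) =
        to (unique⇔↭-allFin π) π! , to (Avoids⇔Avoiding π) avoids ,
        to (BeginsWith-descending d π) begins

      word : ∀ {w} → Arrangement d (allFin n) w → ∃[ π ] Good π × w ≡ toList π
      word {w} arr@(w↭ , _) =
        uncurry (λ π w≡ → π , good π (subst (Arrangement d (allFin n)) w≡ arr) , w≡)
          (toList-surjective w (trans (↭-length w↭) (List.length-tabulate (λ i → i))))
        where
        good : ∀ π → Arrangement d (allFin n) (toList π) → Good π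
        good π (π↭ , avoiding , descends) =
          from (unique⇔↭-allFin π) π↭ , from (Avoids⇔Avoiding π) avoiding ,
          from (BeginsWith-descending d π) descends

-- Power series over a ℚ-algebra

/-≡ : ∀ a b p q .{{_ : NonZero p}} .{{_ : NonZero q}} →
      a ℕ.* q ≡ b ℕ.* p → + a / p ≡ + b / q
/-≡ a b p@(suc _) q@(suc _) eq = ℚ.fromℚᵘ-cong {ℚᵘ.mkℚᵘ (+ a) _} {ℚᵘ.mkℚᵘ (+ b) _} (ℚᵘ.*≡*
  (trans (sym (ℤ.pos-* a q)) (trans (cong +_ eq) (ℤ.pos-* b p))))

toℚᵘ-/ : ∀ i p-1 → ℚ.toℚᵘ (i / suc p-1) ℚᵘ.≃ ℚᵘ.mkℚᵘ i p-1
toℚᵘ-/ i p-1 = ℚ.toℚᵘ-fromℚᵘ (ℚᵘ.mkℚᵘ i p-1)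

/-* : ∀ a b p q .{{_ : NonZero p}} .{{_ : NonZero q}} .{{_ : NonZero (p ℕ.* q)}} →
      (+ a / p) ℚ.* (+ b / q) ≡ + (a ℕ.* b) / (p ℕ.* q)
/-* a b p@(suc p-1) q@(suc q-1) = ℚ.toℚᵘ-injective (begin
  ℚ.toℚᵘ ((+ a / p) ℚ.* (+ b / q))              ≈⟨ ℚ.toℚᵘ-homo-* (+ a / p) (+ b / q) ⟩
  ℚ.toℚᵘ (+ a / p) ℚᵘ.* ℚ.toℚᵘ (+ b / q)        ≈⟨ ℚᵘ.*-cong (toℚᵘ-/ (+ a) p-1) (toℚᵘ-/ (+ b) q-1) ⟩
  ℚᵘ.mkℚᵘ (+ a) p-1 ℚᵘ.* ℚᵘ.mkℚᵘ (+ b) q-1     ≡⟨ cong (λ i → ℚᵘ.mkℚᵘ i _) (sym (ℤ.pos-* a b)) ⟩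
  ℚᵘ.mkℚᵘ (+ (a ℕ.* b)) (q-1 ℕ.+ p-1 ℕ.* q)     ≈⟨ toℚᵘ-/ (+ (a ℕ.* b)) _ ⟨
  ℚ.toℚᵘ (+ (a ℕ.* b) / (p ℕ.* q))              ∎)
  where open SetoidReasoning ℚᵘ.≃-setoid

/-+ : ∀ a b p .{{_ : NonZero p}} → (+ a / p) ℚ.+ (+ b / p) ≡ + (a ℕ.+ b) / p
/-+ a b p@(suc p-1) = ℚ.toℚᵘ-injective (begin
  ℚ.toℚᵘ ((+ a / p) ℚ.+ (+ b / p))              ≈⟨ ℚ.toℚᵘ-homo-+ (+ a / p) (+ b / p) ⟩
  ℚ.toℚᵘ (+ a / p) ℚᵘ.+ ℚ.toℚᵘ (+ b / p)        ≈⟨ ℚᵘ.+-cong (toℚᵘ-/ (+ a) p-1) (toℚᵘ-/ (+ b) p-1) ⟩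
  ℚᵘ.mkℚᵘ (+ a) p-1 ℚᵘ.+ ℚᵘ.mkℚᵘ (+ b) p-1     ≈⟨ ℚᵘ.*≡* (crossMultiply (+ a) (+ b) (+ p)) ⟩
  ℚᵘ.mkℚᵘ (+ (a ℕ.+ b)) p-1                     ≈⟨ toℚᵘ-/ (+ (a ℕ.+ b)) p-1 ⟨
  ℚ.toℚᵘ (+ (a ℕ.+ b) / p)                      ∎)
  where
  open SetoidReasoning ℚᵘ.≃-setoid
  import Data.Integer.Tactic.RingSolver as ℤ-Solver
  crossMultiply : ∀ a b p → (a ℤ.* p ℤ.+ b ℤ.* p) ℤ.* p ≡ (a ℤ.+ b) ℤ.* (p ℤ.* p)
  crossMultiply = ℤ-Solver.solve-∀

module SeriesProperties {c ℓ} (A : ExponentialℚAlgebra c ℓ) where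

  open PowerSeries A
  private
    module A = ExponentialℚAlgebra A
    module fromℚ = IsRingHomomorphism A.fromℚ-homomorphism
    module exp = IsMonoidHomomorphism A.exp-homomorphism
    open RawMonoidDefs A.+-rawMonoid using (sum)
    module Solver = NaturalCoefficients A.commutativeSemiring
    open Solver using (_:=_; _:+_; _:*_; con)

  open SetoidReasoning A.setoid

  -- The commutative ring of power series

  tail : Series → Series
  tail f = f ∘ suc

  scale : A.Carrier → Series → Series
  scale a f n = a A.* f n

  -- By computation `(f * g) (suc n)` is `f 0 A.* g (suc n)` plus `(tail f * g) n`. This recursion
  -- drives the product lemmas; here it shows that a coefficient of a product sees only coefficients
  -- up to its own index.
  *-cong-≤ : ∀ n {f f′ g g′ : Series} →
             (∀ i → i ≤ n → f i A.≈ f′ i) → (∀ i → i ≤ n → g i A.≈ g′ i) →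
             (f * g) n A.≈ (f′ * g′) n
  *-cong-≤ zero    p q = A.+-congʳ (A.*-cong (p 0 z≤n) (q 0 z≤n))
  *-cong-≤ (suc n) p q = A.+-cong (A.*-cong (p 0 z≤n) (q (suc n) ℕ.≤-refl))
    (*-cong-≤ n (λ i i≤n → p (suc i) (s≤s i≤n)) (λ i i≤n → q i (ℕ.m≤n⇒m≤1+n i≤n)))

  *-congₛ : ∀ {f f′ g g′ : Series} → f ≈ f′ → g ≈ g′ → f * g ≈ f′ * g′
  *-congₛ p q n = *-cong-≤ n (λ i _ → p i) (λ i _ → q i)

  const-0 : ∀ n → const A.0# n A.≈ A.0#
  const-0 zero    = A.refl
  const-0 (suc n) = A.refl

  zeroˡₛ : ∀ {f : Series} → (∀ n → f n A.≈ A.0#) → ∀ g n → (f * g) n A.≈ A.0#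
  zeroˡₛ {f} f≈0 g zero = begin
    f 0 A.* g 0 A.+ A.0#  ≈⟨ A.+-congʳ (A.*-congʳ (f≈0 0)) ⟩
    A.0# A.* g 0 A.+ A.0# ≈⟨ A.trans (A.+-identityʳ _) (A.zeroˡ _) ⟩
    A.0#                  ∎
  zeroˡₛ {f} f≈0 g (suc n) = begin
    f 0 A.* g (suc n) A.+ (tail f * g) n ≈⟨ A.+-cong (A.*-congʳ (f≈0 0)) (zeroˡₛ (f≈0 ∘ suc) g n) ⟩
    A.0# A.* g (suc n) A.+ A.0#          ≈⟨ A.trans (A.+-identityʳ _) (A.zeroˡ _) ⟩
    A.0#                                 ∎

  identityˡₛ : ∀ f → 1# * f ≈ f
  identityˡₛ f zero    = A.trans (A.+-identityʳ _) (A.*-identityˡ _)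
  identityˡₛ f (suc n) =
    A.trans (A.+-cong (A.*-identityˡ _) (zeroˡₛ (λ _ → A.refl) f n)) (A.+-identityʳ _)

  distribʳₛ : ∀ f g h → (g + h) * f ≈ g * f + h * f
  distribʳₛ f g h zero =
    Solver.solve 3
      (λ a b c →
        (b :+ c) :* a :+ con 0 :=
        (b :* a :+ con 0) :+ (c :* a :+ con 0))
      A.refl (f 0) (g 0) (h 0)
  distribʳₛ f g h (suc n) = A.trans (A.+-congˡ (distribʳₛ f (tail g) (tail h) n))
    (Solver.solve 5
        (λ a b c d e → (b :+ c) :* a :+ (d :+ e) := (b :* a :+ d) :+ (c :* a :+ e))
        A.refl (f (suc n)) (g 0) (h 0) ((tail g * f) n) ((tail h * f) n))

  -- Peels off the last summand instead of the first, which is what the exchanged product in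
  -- commutativity calls for.
  *-sucʳ : ∀ f g n → (f * g) (suc n) A.≈ (f * tail g) n A.+ f (suc n) A.* g 0
  *-sucʳ f g zero =
    Solver.solve 2
      (λ a b → a :+ (b :+ con 0) := a :+ con 0 :+ b)
      A.refl (f 0 A.* g 1) (f 1 A.* g 0)
  *-sucʳ f g (suc n) = A.trans (A.+-congˡ (*-sucʳ (tail f) g n)) (A.sym (A.+-assoc _ _ _))

  *-commₛ : ∀ f g → f * g ≈ g * f
  *-commₛ f g zero    = A.+-congʳ (A.*-comm _ _)
  *-commₛ f g (suc n) = begin
    f 0 A.* g (suc n) A.+ (tail f * g) n ≈⟨ A.+-cong (A.*-comm _ _) (*-commₛ (tail f) g n) ⟩
    g (suc n) A.* f 0 A.+ (g * tail f) n ≈⟨ A.+-comm _ _ ⟩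
    (g * tail f) n A.+ g (suc n) A.* f 0 ≈⟨ *-sucʳ g f n ⟨
    (g * f) (suc n)                      ∎

  scale-* : ∀ a f g → scale a f * g ≈ scale a (f * g)
  scale-* a f g zero =
    Solver.solve 3
      (λ a b c → a :* b :* c :+ con 0 := a :* (b :* c :+ con 0))
      A.refl a (f 0) (g 0)
  scale-* a f g (suc n) = A.trans (A.+-congˡ (scale-* a (tail f) g n))
    (Solver.solve 4
        (λ a b c d → a :* b :* c :+ a :* d := a :* (b :* c :+ d))
        A.refl a (f 0) (g (suc n)) ((tail f * g) n))

  *-assocₛ : ∀ f g h → (f * g) * h ≈ f * (g * h)
  *-assocₛ f g h zero =
    Solver.solve 3
      (λ a b c →
        (a :* b :+ con 0) :* c :+ con 0 :=
        a :* (b :* c :+ con 0) :+ con 0)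
      A.refl (f 0) (g 0) (h 0)
  *-assocₛ f g h (suc n) = begin
    -- By computation `tail (f * g)` is `scale (f 0) (tail g) + tail f * g`.
    (f 0 A.* g 0 A.+ A.0#) A.* h (suc n) A.+ ((scale (f 0) (tail g) + tail f * g) * h) n
      ≈⟨ A.+-congˡ (distribʳₛ h (scale (f 0) (tail g)) (tail f * g) n) ⟩
    (f 0 A.* g 0 A.+ A.0#) A.* h (suc n) A.+ ((scale (f 0) (tail g) * h) n A.+ ((tail f * g) * h) n)
      ≈⟨ A.+-congˡ (A.+-cong (scale-* (f 0) (tail g) h n) (*-assocₛ (tail f) g h n)) ⟩
    (f 0 A.* g 0 A.+ A.0#) A.* h (suc n) A.+ (f 0 A.* (tail g * h) n A.+ (tail f * (g * h)) n)
      ≈⟨ Solver.solve 5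
          (λ a b c d e →
            (a :* b :+ con 0) :* c :+ (a :* d :+ e) :=
            a :* (b :* c :+ d) :+ e)
          A.refl (f 0) (g 0) (h (suc n)) ((tail g * h) n) ((tail f * (g * h)) n) ⟩
    f 0 A.* (g 0 A.* h (suc n) A.+ (tail g * h) n) A.+ (tail f * (g * h)) n ∎

  seriesRing : CommutativeRing c ℓ
  seriesRing = record
    { isCommutativeRing = record
      { isRing = record
        { +-isAbelianGroup = record
          { isGroup = record
            { isMonoid = record
              { isSemigroup = record
                { isMagma = record
                  { isEquivalence = record
                    { refl  = λ _ → A.refl
                    ; sym   = λ p n → A.sym (p n)
                    ; trans = λ p q n → A.trans (p n) (q n)
                    }
                  ; ∙-cong = λ p q n → A.+-cong (p n) (q n)
                  }
                ; assoc = λ f g h n → A.+-assoc (f n) (g n) (h n)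
                }
              ; identity =
                  (λ f n → A.trans (A.+-congʳ (const-0 n)) (A.+-identityˡ (f n))) ,
                  (λ f n → A.trans (A.+-congˡ (const-0 n)) (A.+-identityʳ (f n)))
              }
            ; inverse =
                (λ f n → A.trans (A.-‿inverseˡ (f n)) (A.sym (const-0 n))) ,
                (λ f n → A.trans (A.-‿inverseʳ (f n)) (A.sym (const-0 n)))
            ; ⁻¹-cong = λ p n → A.-‿cong (p n)
            }
          ; comm = λ f g n → A.+-comm (f n) (g n)
          }
        ; *-cong     = *-congₛ
        ; *-assoc    = *-assocₛ
        ; *-identity = identityˡₛ , λ f n → A.trans (*-commₛ f 1# n) (identityˡₛ f n)
        ; distrib    =
            (λ f g h n → A.trans (*-commₛ f (g + h) n) (A.trans (distribʳₛ f g h n)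
              (A.+-cong (*-commₛ g f n) (*-commₛ h f n)))) ,
            distribʳₛ
        }
      ; *-comm = *-commₛ
      }
    }

  private
    module S = CommutativeRing seriesRing
    module SeriesSolver = NaturalCoefficients S.commutativeSemiring
    open SeriesSolver using () renaming (_:=_ to _⊜_; _:+_ to _⊕_; _:*_ to _⊗_)

  -- Rational scalars

  frac : (a p : ℕ) .{{_ : NonZero p}} → A.Carrier
  frac a p = A.fromℚ (+ a / p)

  frac-≡ : ∀ a b p q .{{_ : NonZero p}} .{{_ : NonZero q}} →
           a ℕ.* q ≡ b ℕ.* p → frac a p A.≈ frac b q
  frac-≡ a b p q eq = fromℚ.⟦⟧-cong (/-≡ a b p q eq)

  frac-* : ∀ a b p q .{{_ : NonZero p}} .{{_ : NonZero q}} .{{_ : NonZero (p ℕ.* q)}} →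
           frac a p A.* frac b q A.≈ frac (a ℕ.* b) (p ℕ.* q)
  frac-* a b p q = A.trans (A.sym (fromℚ.*-homo _ _)) (fromℚ.⟦⟧-cong (/-* a b p q))

  frac-+ : ∀ a b p .{{_ : NonZero p}} → frac a p A.+ frac b p A.≈ frac (a ℕ.+ b) p
  frac-+ a b p = A.trans (A.sym (fromℚ.+-homo _ _)) (fromℚ.⟦⟧-cong (/-+ a b p))

  frac-0 : ∀ p .{{_ : NonZero p}} → frac 0 p A.≈ A.0#
  frac-0 p = A.trans (frac-≡ 0 0 p 1 refl) fromℚ.0#-homo

  frac-1 : frac 1 1 A.≈ A.1#
  frac-1 = fromℚ.1#-homo

  nat : ℕ → A.Carrier
  nat n = frac n 1

  nat-suc : ∀ n → nat (suc n) A.≈ A.1# A.+ nat n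
  nat-suc n = A.trans (A.sym (frac-+ 1 n 1)) (A.+-congʳ frac-1)

  nat-inverse : ∀ n → frac 1 (suc n) A.* nat (suc n) A.≈ A.1#
  nat-inverse n = begin
    frac 1 (suc n) A.* nat (suc n)          ≈⟨ frac-* 1 (suc n) (suc n) 1 ⟩
    frac (1 ℕ.* suc n) (suc n ℕ.* 1)        ≈⟨ frac-≡ (1 ℕ.* suc n) 1 (suc n ℕ.* 1) 1 (lemma (suc n)) ⟩
    frac 1 1                                ≈⟨ frac-1 ⟩
    A.1#                                    ∎
    where
    lemma : ∀ n → 1 ℕ.* n ℕ.* 1 ≡ 1 ℕ.* (n ℕ.* 1)
    lemma = ℕ-Solver.solve-∀

  -- Positive integers are invertible in a ℚ-algebra; this is what allows a coefficient to be
  -- recovered from the derivative.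
  nat-cancel : ∀ n {a b} → nat (suc n) A.* a A.≈ nat (suc n) A.* b → a A.≈ b
  nat-cancel n {a} {b} eq = A.trans (A.sym (undo a)) (A.trans (A.*-congˡ eq) (undo b))
    where
    undo : ∀ a → frac 1 (suc n) A.* (nat (suc n) A.* a) A.≈ a
    undo a = A.trans (A.sym (A.*-assoc _ _ _)) (A.trans (A.*-congʳ (nat-inverse n)) (A.*-identityˡ a))

  nat-frac-! : ∀ n a → let instance _ = n !≢0; _ = suc n !≢0 in
               nat (suc n) A.* frac a (suc n !) A.≈ frac a (n !)
  nat-frac-! n a = A.trans (frac-* (suc n) a 1 (suc n !))
    (frac-≡ (suc n ℕ.* a) a (1 ℕ.* suc n !) (n !) (lemma (suc n) a (n !)))
    where
    instance _ = n !≢0; _ = suc n !≢0; _ = ℕ.m*n≢0 1 (suc n !)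
    lemma : ∀ n a m → n ℕ.* a ℕ.* m ≡ a ℕ.* (1 ℕ.* (n ℕ.* m))
    lemma = ℕ-Solver.solve-∀

  -- Formal derivatives and linear differential equations

  D : Series → Series
  D f n = nat (suc n) A.* f (suc n)

  D-cong : ∀ {f g} → f ≈ g → D f ≈ D g
  D-cong p n = A.*-congˡ (p (suc n))

  D-+ : ∀ f g → D (f + g) ≈ D f + D g
  D-+ f g n = A.distribˡ _ _ _

  D-scale : ∀ a f → D (scale a f) ≈ scale a (D f)
  D-scale a f n =
    Solver.solve 3
      (λ a b c → a :* (b :* c) := b :* (a :* c))
      A.refl (nat (suc n)) a (f (suc n))

  D-- : ∀ f → D (- f) ≈ - D f
  D-- f n = A.sym (-‿distribʳ-* _ _)
    where open RingProperties A.ring using (-‿distribʳ-*)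

  D-const : ∀ a → D (const a) ≈ 0#
  D-const a n = A.trans (A.zeroʳ _) (A.sym (const-0 n))

  D-injective : ∀ {f g} → f 0 A.≈ g 0 → D f ≈ D g → f ≈ g
  D-injective p q zero    = p
  D-injective p q (suc n) = nat-cancel n (q n)

  -- Leibniz rule, by induction on the coefficient. The factor `nat (suc (suc n))` splits as one
  -- plus `nat (suc n)`: the latter gives the rule for `tail f`, and the former supplies the extra
  -- `tail f′` in `tail-D`.
  D-* : ∀ f g → D (f * g) ≈ D f * g + f * D g
  D-* f g zero =
    Solver.solve 5
      (λ ν f₀ f₁ g₀ g₁ →
        ν :* (f₀ :* g₁ :+ (f₁ :* g₀ :+ con 0)) :=
        (ν :* f₁ :* g₀ :+ con 0) :+ (f₀ :* (ν :* g₁) :+ con 0))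
      A.refl (nat 1) (f 0) (f 1) (g 0) (g 1)
  D-* f g (suc n) = begin
    ν′ A.* (f 0 A.* g₂ A.+ (f 1 A.* g₁ A.+ (tail f′ * g) n))
      ≈⟨ Solver.solve 4
          (λ a b c d → a :* (b :* c :+ d) := b :* (a :* c) :+ a :* d)
          A.refl ν′ (f 0) g₂ (f 1 A.* g₁ A.+ (tail f′ * g) n) ⟩
    f 0 A.* (ν′ A.* g₂) A.+ ν′ A.* (f′ * g) (suc n)
      ≈⟨ A.+-congˡ (A.*-congʳ (nat-suc (suc n))) ⟩
    f 0 A.* (ν′ A.* g₂) A.+ (A.1# A.+ nat (suc n)) A.* (f′ * g) (suc n)
      ≈⟨ A.+-congˡ (A.trans (A.distribʳ _ _ _) (A.+-cong (A.*-identityˡ _) (D-* f′ g n))) ⟩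
    f 0 A.* (ν′ A.* g₂) A.+ ((f 1 A.* g₁ A.+ (tail f′ * g) n) A.+ ((D f′ * g) n A.+ (f′ * D g) n))
      ≈⟨ Solver.solve 6
          (λ a b c d e f →
            a :+ ((b :* c :+ d) :+ (e :+ f)) :=
            b :* c :+ (d :+ e) :+ (a :+ f))
          A.refl (f 0 A.* (ν′ A.* g₂)) (f 1) g₁ ((tail f′ * g) n) ((D f′ * g) n) ((f′ * D g) n) ⟩
    f 1 A.* g₁ A.+ ((tail f′ * g) n A.+ (D f′ * g) n) A.+ (f 0 A.* (ν′ A.* g₂) A.+ (f′ * D g) n)
      ≈⟨ A.+-congʳ (A.+-cong (A.*-congʳ (A.trans (A.*-congʳ frac-1) (A.*-identityˡ _)))
           (distribʳₛ g (tail f′) (D f′) n)) ⟨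
    nat 1 A.* f 1 A.* g₁ A.+ ((tail f′ + D f′) * g) n A.+ (f * D g) (suc n)
      ≈⟨ A.+-congʳ (A.+-congˡ (*-congₛ {g = g} tail-D (λ _ → A.refl) n)) ⟨
    (D f * g) (suc n) A.+ (f * D g) (suc n) ∎
    where
    f′ = tail f
    ν′ = nat (suc (suc n))
    g₁ = g (suc n)
    g₂ = g (suc (suc n))

    tail-D : tail (D f) ≈ tail f′ + D f′
    tail-D i = A.trans (A.*-congʳ (nat-suc (suc i)))
      (A.trans (A.distribʳ _ _ _) (A.+-congʳ (A.*-identityˡ _)))

  -- Coefficient `i` of the equation expresses a nonzero integer multiple of `f (suc i)` through the
  -- coefficients of `f` up to `i`.
  linearODE-unique : ∀ {f g a h : Series} → D f ≈ a * f + h → D g ≈ a * g + h →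
                     f 0 A.≈ g 0 → f ≈ g
  linearODE-unique {f} {g} {a} {h} Df Dg p n = agree n n ℕ.≤-refl
    where
    agree : ∀ n i → i ≤ n → f i A.≈ g i
    agree n       zero    _         = p
    agree (suc n) (suc i) (s≤s i≤n) = nat-cancel i (begin
      D f i               ≈⟨ Df i ⟩
      (a * f) i A.+ h i   ≈⟨ A.+-congʳ (*-cong-≤ i {f = a} (λ _ _ → A.refl)
                               (λ j j≤i → agree n j (ℕ.≤-trans j≤i i≤n))) ⟩
      (a * g) i A.+ h i   ≈⟨ Dg i ⟨
      D g i               ∎)

  D-∫ : ∀ f → D (∫ f) ≈ f
  D-∫ f n = begin
    nat (suc n) A.* (frac 1 (suc n) A.* f n)
      ≈⟨ Solver.solve 3 (λ a b c → a :* (b :* c) := b :* a :* c)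
           A.refl (nat (suc n)) (frac 1 (suc n)) (f n) ⟩
    frac 1 (suc n) A.* nat (suc n) A.* f n   ≈⟨ A.*-congʳ (nat-inverse n) ⟩
    A.1# A.* f n                             ≈⟨ A.*-identityˡ _ ⟩
    f n                                      ∎

  -- Each factor without constant term raises the order of the product by at least one.
  ^-constant : ∀ {f} → f 0 A.≈ A.0# → ∀ m n → n < m → (f ^ m) n A.≈ A.0#
  ^-constant {f} f₀≈0 (suc m) zero _ = begin
    f 0 A.* (f ^ m) 0 A.+ A.0#  ≈⟨ A.+-identityʳ _ ⟩
    f 0 A.* (f ^ m) 0           ≈⟨ A.*-congʳ f₀≈0 ⟩
    A.0# A.* (f ^ m) 0          ≈⟨ A.zeroˡ _ ⟩
    A.0#                        ∎
  ^-constant {f} f₀≈0 (suc m) (suc n) (s≤s n<m) = begin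
    f 0 A.* (f ^ m) (suc n) A.+ (tail f * f ^ m) n
      ≈⟨ A.+-cong (A.*-congʳ f₀≈0) (*-cong-≤ n {f = tail f} (λ _ _ → A.refl)
           (λ i i≤n → A.trans (^-constant f₀≈0 m i (ℕ.≤-<-trans i≤n n<m)) (A.sym (const-0 i)))) ⟩
    A.0# A.* (f ^ m) (suc n) A.+ (tail f * 0#) n
      ≈⟨ A.+-cong (A.zeroˡ _) (A.trans (S.zeroʳ (tail f) n) (const-0 n)) ⟩
    A.0# A.+ A.0#
      ≈⟨ A.+-identityˡ _ ⟩
    A.0# ∎

  D-^ : ∀ f m → D (f ^ suc m) ≈ scale (nat (suc m)) (f ^ m * D f)
  D-^ f zero n = begin
    D (f * 1#) n                             ≈⟨ D-cong (S.*-identityʳ f) n ⟩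
    D f n                                    ≈⟨ S.*-identityˡ (D f) n ⟨
    (1# * D f) n                             ≈⟨ A.*-identityˡ _ ⟨
    A.1# A.* (1# * D f) n                    ≈⟨ A.*-congʳ frac-1 ⟨
    nat 1 A.* (1# * D f) n                   ∎
  D-^ f (suc m) n = begin
    D (f * f ^ suc m) n
      ≈⟨ D-* f (f ^ suc m) n ⟩
    (D f * f ^ suc m) n A.+ (f * D (f ^ suc m)) n
      ≈⟨ A.+-cong (S.*-comm (D f) (f ^ suc m) n) (begin
           (f * D (f ^ suc m)) n                            ≈⟨ S.*-congˡ {f} (D-^ f m) n ⟩
           (f * scale (nat (suc m)) (f ^ m * D f)) n
             ≈⟨ S.*-comm f (scale (nat (suc m)) (f ^ m * D f)) n ⟩
           (scale (nat (suc m)) (f ^ m * D f) * f) n        ≈⟨ scale-* _ (f ^ m * D f) f n ⟩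
           nat (suc m) A.* ((f ^ m * D f) * f) n            ≈⟨ A.*-congˡ (
             SeriesSolver.solve 3
               (λ u v w → u ⊗ v ⊗ w ⊜ w ⊗ u ⊗ v)
               (λ _ → A.refl) (f ^ m) (D f) f n) ⟩
           nat (suc m) A.* ((f ^ suc m) * D f) n            ∎) ⟩
    (f ^ suc m * D f) n A.+ nat (suc m) A.* (f ^ suc m * D f) n
      ≈⟨ A.+-congʳ (A.*-identityˡ _) ⟨
    A.1# A.* (f ^ suc m * D f) n A.+ nat (suc m) A.* (f ^ suc m * D f) n
      ≈⟨ A.distribʳ _ _ _ ⟨
    (A.1# A.+ nat (suc m)) A.* (f ^ suc m * D f) n
      ≈⟨ A.*-congʳ (nat-suc (suc m)) ⟨
    nat (suc (suc m)) A.* (f ^ suc m * D f) n ∎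

  -- The exponential of a series

  sumSeries : ∀ {k} → (Fin k → Series) → Series
  sumSeries t n = sum λ i → t i n

  sumSeries-cong : ∀ {k} {t u : Fin k → Series} → (∀ i → t i ≈ u i) → sumSeries t ≈ sumSeries u
  sumSeries-cong {zero}  p n = A.refl
  sumSeries-cong {suc k} p n = A.+-cong (p 0F n) (sumSeries-cong (p ∘ sucF) n)

  D-sumSeries : ∀ {k} (t : Fin k → Series) → D (sumSeries t) ≈ sumSeries (D ∘ t)
  D-sumSeries {zero}  t n = A.zeroʳ _
  D-sumSeries {suc k} t n = A.trans (A.distribˡ _ _ _) (A.+-congˡ (D-sumSeries (t ∘ sucF) n))

  sumSeries-* : ∀ {k} (t : Fin k → Series) g → sumSeries t * g ≈ sumSeries (λ i → t i * g)
  sumSeries-* {zero}  t g = zeroˡₛ (λ _ → A.refl) g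
  sumSeries-* {suc k} t g n = A.trans (distribʳₛ g (t 0F) (sumSeries (t ∘ sucF)) n)
    (A.+-congˡ (sumSeries-* (t ∘ sucF) g n))

  sum-zero : ∀ k (u : ℕ → A.Carrier) → (∀ m → u m A.≈ A.0#) → sum {k} (u ∘ toℕ) A.≈ A.0#
  sum-zero zero    u p = A.refl
  sum-zero (suc k) u p = A.trans (A.+-cong (p 0) (sum-zero k (u ∘ suc) (p ∘ suc))) (A.+-identityˡ _)

  sum-truncate : ∀ n k (u : ℕ → A.Carrier) → n < k → (∀ m → n < m → u m A.≈ A.0#) →
                 sum {k} (u ∘ toℕ) A.≈ sum {suc n} (u ∘ toℕ)
  sum-truncate zero (suc k) u _ p = A.+-congˡ (sum-zero k (u ∘ suc) (λ m → p (suc m) z<s))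
  sum-truncate (suc n) (suc k) u (s≤s n<k) p =
    A.+-congˡ (sum-truncate n k (u ∘ suc) n<k (λ m n<m → p (suc m) (s<s n<m)))

  expTerm : Series → ℕ → Series
  expTerm f m = (1/ m !) • (f ^ m)

  -- In `e^_` the number of summands grows with the index of the coefficient. A fixed bound `M`
  -- gives a genuine finite sum of series, which can be differentiated term by term.
  expPartial : Series → ℕ → Series
  expPartial f M = sumSeries {suc M} (expTerm f ∘ toℕ)

  D-expTerm : ∀ f m → D (expTerm f (suc m)) ≈ expTerm f m * D f
  D-expTerm f m n = begin
    D (scale (A.fromℚ (1/ suc m !)) (f ^ suc m)) n
      ≈⟨ D-scale _ (f ^ suc m) n ⟩
    A.fromℚ (1/ suc m !) A.* D (f ^ suc m) n
      ≈⟨ A.*-congˡ (D-^ f m n) ⟩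
    A.fromℚ (1/ suc m !) A.* (nat (suc m) A.* (f ^ m * D f) n)
      ≈⟨ Solver.solve 3 (λ a b c → a :* (b :* c) := b :* a :* c) A.refl _ _ _ ⟩
    nat (suc m) A.* A.fromℚ (1/ suc m !) A.* (f ^ m * D f) n
      ≈⟨ A.*-congʳ (nat-frac-! m 1) ⟩
    A.fromℚ (1/ m !) A.* (f ^ m * D f) n
      ≈⟨ scale-* _ (f ^ m) (D f) n ⟨
    (expTerm f m * D f) n ∎

  D-expPartial : ∀ f M → D (expPartial f (suc M)) ≈ expPartial f M * D f
  D-expPartial f M n = begin
    D (expPartial f (suc M)) n
      ≈⟨ D-sumSeries {suc (suc M)} (expTerm f ∘ toℕ) n ⟩
    D (expTerm f 0) n A.+ sumSeries {suc M} (λ i → D (expTerm f (suc (toℕ i)))) n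
      ≈⟨ A.+-congʳ (A.trans (A.*-congˡ (A.zeroʳ _)) (A.zeroʳ _)) ⟩
    A.0# A.+ sumSeries {suc M} (λ i → D (expTerm f (suc (toℕ i)))) n
      ≈⟨ A.+-identityˡ _ ⟩
    sumSeries {suc M} (λ i → D (expTerm f (suc (toℕ i)))) n
      ≈⟨ sumSeries-cong {suc M} (λ i → D-expTerm f (toℕ i)) n ⟩
    sumSeries {suc M} (λ i → expTerm f (toℕ i) * D f) n
      ≈⟨ sumSeries-* {suc M} (expTerm f ∘ toℕ) (D f) n ⟨
    (expPartial f M * D f) n ∎

  e^-expPartial : ∀ f M n → n ≤ M →
    (e^ f) n A.≈ scale (A.exp (f 0)) (expPartial (dropConstant f) M) n
  e^-expPartial f M n n≤M = A.*-congˡ (A.sym (sum-truncate n (suc M)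
    (λ m → expTerm (dropConstant f) m n) (s≤s n≤M)
    (λ m n<m → A.trans (A.*-congˡ (^-constant A.refl m n n<m)) (A.zeroʳ _))))

  -- Coefficient `n` of the derivative involves the partial sum up to `suc n`. Differentiation
  -- lowers the bound to `n`, where the partial sum still agrees with `e^ f` in all coefficients
  -- that matter.
  D-e^ : ∀ f → D (e^ f) ≈ e^ f * D f
  D-e^ f n = begin
    nat (suc n) A.* (A.exp (f 0) A.* expPartial g (suc n) (suc n))
      ≈⟨ D-scale (A.exp (f 0)) (expPartial g (suc n)) n ⟩
    A.exp (f 0) A.* D (expPartial g (suc n)) n
      ≈⟨ A.*-congˡ (D-expPartial g n n) ⟩
    A.exp (f 0) A.* (expPartial g n * D g) n
      ≈⟨ scale-* (A.exp (f 0)) (expPartial g n) (D g) n ⟨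
    -- `D g` becomes `D f` by computation, since the two series differ only in the constant term.
    (scale (A.exp (f 0)) (expPartial g n) * D f) n
      ≈⟨ *-cong-≤ n {g = D f} (e^-expPartial f n) (λ _ _ → A.refl) ⟨
    (e^ f * D f) n ∎
    where g = dropConstant f

  e^-0 : ∀ f → (e^ f) 0 A.≈ A.exp (f 0)
  e^-0 f = begin
    A.exp (f 0) A.* (frac 1 1 A.* A.1# A.+ A.0#) ≈⟨ A.*-congˡ (A.+-congʳ (A.*-congʳ frac-1)) ⟩
    A.exp (f 0) A.* (A.1# A.* A.1# A.+ A.0#)
      ≈⟨ A.*-congˡ (A.trans (A.+-identityʳ _) (A.*-identityˡ _)) ⟩
    A.exp (f 0) A.* A.1#                         ≈⟨ A.*-identityʳ _ ⟩
    A.exp (f 0)                                  ∎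

  e^-unique : ∀ {f g} → D f ≈ f * D g → f 0 A.≈ A.exp (g 0) → f ≈ e^ g
  e^-unique {f} {g} Df f₀ = linearODE-unique {a = D g} {h = 0#}
    (homogeneous {f} Df) (homogeneous {e^ g} (D-e^ g)) (A.trans f₀ (A.sym (e^-0 g)))
    where
    homogeneous : ∀ {f} → D f ≈ f * D g → D f ≈ D g * f + 0#
    homogeneous {f} p n = A.trans (p n)
      (A.trans (S.*-comm f (D g) n) (A.sym (S.+-identityʳ (D g * f) n)))

  -- The product satisfies the differential equation of `e^ h`, and the constant terms agree because
  -- `exp` is a homomorphism. Taking the sum up to `≈` accommodates exponents that partly cancel.
  e^-+ : ∀ {f g h} → f + g ≈ h → e^ f * e^ g ≈ e^ h
  e^-+ {f} {g} {h} p = e^-unique {e^ f * e^ g} {h}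
    (λ n → begin
      D (e^ f * e^ g) n                                  ≈⟨ D-* (e^ f) (e^ g) n ⟩
      (D (e^ f) * e^ g + e^ f * D (e^ g)) n
        ≈⟨ A.+-cong (S.*-congʳ {e^ g} (D-e^ f) n) (S.*-congˡ {e^ f} (D-e^ g) n) ⟩
      (e^ f * D f * e^ g + e^ f * (e^ g * D g)) n        ≈⟨ SeriesSolver.solve 4
          (λ u v w z → u ⊗ w ⊗ v ⊕ u ⊗ (v ⊗ z) ⊜ u ⊗ v ⊗ (w ⊕ z))
          (λ _ → A.refl) (e^ f) (e^ g) (D f) (D g) n ⟩
      (e^ f * e^ g * (D f + D g)) n                      ≈⟨ S.*-congˡ {e^ f * e^ g} (D-+ f g) n ⟨
      (e^ f * e^ g * D (f + g)) n                        ≈⟨ S.*-congˡ {e^ f * e^ g} (D-cong p) n ⟩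
      (e^ f * e^ g * D h) n                              ∎)
    (begin
      (e^ f) 0 A.* (e^ g) 0 A.+ A.0#   ≈⟨ A.+-identityʳ _ ⟩
      (e^ f) 0 A.* (e^ g) 0            ≈⟨ A.*-cong (e^-0 f) (e^-0 g) ⟩
      A.exp (f 0) A.* A.exp (g 0)      ≈⟨ exp.homo (f 0) (g 0) ⟨
      A.exp (f 0 A.+ g 0)              ≈⟨ exp.⟦⟧-cong (p 0) ⟩
      A.exp (h 0)                      ∎)

  D-x : D x ≈ 1#
  D-x zero    = A.trans (A.*-congʳ frac-1) (A.*-identityˡ _)
  D-x (suc n) = A.zeroʳ _

  D-e^x : D (e^ x) ≈ e^ x
  D-e^x n = begin
    D (e^ x) n      ≈⟨ D-e^ x n ⟩
    (e^ x * D x) n  ≈⟨ S.*-congˡ {e^ x} D-x n ⟩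
    (e^ x * 1#) n   ≈⟨ S.*-identityʳ (e^ x) n ⟩
    (e^ x) n        ∎

  e^x-0 : (e^ x) 0 A.≈ A.1#
  e^x-0 = A.trans (e^-0 x) exp.ε-homo

  -- Exponential generating functions

  egf : (ℕ → ℕ) → Series
  egf g n = frac (g n) (n !)
    where instance _ = n !≢0

  egf-+ : ∀ g h → egf (λ n → g n ℕ.+ h n) ≈ egf g + egf h
  egf-+ g h n = A.sym (frac-+ (g n) (h n) (n !))
    where instance _ = n !≢0

  egf-cong : ∀ {g h} → (∀ n → g n ≡ h n) → egf g ≈ egf h
  egf-cong p n = A.reflexive (cong (λ a → frac a (n !)) (p n))
    where instance _ = n !≢0

  D-egf : ∀ g → D (egf g) ≈ egf (g ∘ suc)
  D-egf g n = nat-frac-! n (g (suc n))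

  -- As `e^ x` is its own derivative and `D` shifts the sequence of an `egf`, the Leibniz rule
  -- reproduces Pascal's rule.
  e^x-*-egf : ∀ g → e^ x * egf g ≈ egf (binomialTransform g)
  e^x-*-egf g zero = begin
    (e^ x) 0 A.* frac (g 0) 1 A.+ A.0# ≈⟨ A.+-identityʳ _ ⟩
    (e^ x) 0 A.* frac (g 0) 1          ≈⟨ A.*-congʳ e^x-0 ⟩
    A.1# A.* frac (g 0) 1              ≈⟨ A.*-identityˡ _ ⟩
    frac (g 0) 1                       ∎
  e^x-*-egf g (suc n) = nat-cancel n (begin
    D (e^ x * egf g) n
      ≈⟨ D-* (e^ x) (egf g) n ⟩
    (D (e^ x) * egf g) n A.+ (e^ x * D (egf g)) n
      ≈⟨ A.+-cong (S.*-congʳ {egf g} D-e^x n) (S.*-congˡ {e^ x} (D-egf g) n) ⟩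
    (e^ x * egf g) n A.+ (e^ x * egf (g ∘ suc)) n
      ≈⟨ A.+-cong (e^x-*-egf g n) (e^x-*-egf (g ∘ suc) n) ⟩
    egf (binomialTransform g) n A.+ egf (binomialTransform (g ∘ suc)) n
      ≈⟨ A.+-comm _ _ ⟩
    egf (binomialTransform (g ∘ suc)) n A.+ egf (binomialTransform g) n
      ≈⟨ egf-+ (binomialTransform (g ∘ suc)) (binomialTransform g) n ⟨
    egf (binomialTransform g ∘ suc) n
      ≈⟨ D-egf (binomialTransform g) n ⟨
    D (egf (binomialTransform g)) n ∎)

  -- Differentiation lowers the index by one on both sides, so the identity reduces to constant
  -- terms.
  egf-kronecker : ∀ d → egf (kronecker d) ≈ (1/ d !) • x ^ d
  egf-kronecker zero zero    = A.sym (A.*-identityʳ _)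
  egf-kronecker zero (suc n) = A.trans (frac-0 (suc n !)) (A.sym (A.zeroʳ _))
    where instance _ = suc n !≢0
  egf-kronecker (suc d) = D-injective
    (begin
      frac 0 1                            ≈⟨ frac-0 1 ⟩
      A.0#                                ≈⟨ A.zeroʳ _ ⟨
      A.fromℚ (1/ suc d !) A.* A.0#       ≈⟨ A.*-congˡ (^-constant {x} A.refl (suc d) 0 z<s) ⟨
      A.fromℚ (1/ suc d !) A.* (x ^ suc d) 0 ∎)
    λ n → begin
      D (egf (kronecker (suc d))) n       ≈⟨ D-egf (kronecker (suc d)) n ⟩
      egf (kronecker d) n                 ≈⟨ egf-kronecker d n ⟩
      expTerm x d n                       ≈⟨ S.*-identityʳ (expTerm x d) n ⟨
      (expTerm x d * 1#) n                ≈⟨ S.*-congˡ {expTerm x d} D-x n ⟨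
      (expTerm x d * D x) n               ≈⟨ D-expTerm x d n ⟨
      D (expTerm x (suc d)) n             ∎

-- Order isomorphism with the two patterns

private
  both : ∀ {P Q : Set} → P → Q → P ⇔ Q
  both p q = mk⇔ (λ _ → q) (λ _ → p)

  neither : ∀ {P Q : Set} → ¬ P → ¬ Q → P ⇔ Q
  neither ¬p ¬q = mk⇔ (λ p → contradiction p ¬p) (λ q → contradiction q ¬q)

≤⇒both≮ : ∀ {a b c d : ℕ} → a ≤ b → c ≤ d → (b < a) ⇔ (d < c)
≤⇒both≮ a≤b c≤d = neither (ℕ.≤⇒≯ a≤b) (ℕ.≤⇒≯ c≤d)

orderIsomorphic-increasing : ∀ {a b c a′ b′ c′} → a < b → b < c → a′ < b′ → b′ < c′ →
  OrderIsomorphic (a ∷ b ∷ c ∷ []) (a′ ∷ b′ ∷ c′ ∷ [])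
orderIsomorphic-increasing a<b b<c a′<b′ b′<c′ = λ where
  0F               0F               → ≤⇒both≮ ℕ.≤-refl ℕ.≤-refl
  0F               (sucF 0F)        → both a<b a′<b′
  0F               (sucF (sucF 0F)) → both (ℕ.<-trans a<b b<c) (ℕ.<-trans a′<b′ b′<c′)
  (sucF 0F)        0F               → ≤⇒both≮ (ℕ.<⇒≤ a<b) (ℕ.<⇒≤ a′<b′)
  (sucF 0F)        (sucF 0F)        → ≤⇒both≮ ℕ.≤-refl ℕ.≤-refl
  (sucF 0F)        (sucF (sucF 0F)) → both b<c b′<c′
  (sucF (sucF 0F)) 0F               →
    ≤⇒both≮ (ℕ.<⇒≤ (ℕ.<-trans a<b b<c)) (ℕ.<⇒≤ (ℕ.<-trans a′<b′ b′<c′))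
  (sucF (sucF 0F)) (sucF 0F)        → ≤⇒both≮ (ℕ.<⇒≤ b<c) (ℕ.<⇒≤ b′<c′)
  (sucF (sucF 0F)) (sucF (sucF 0F)) → ≤⇒both≮ ℕ.≤-refl ℕ.≤-refl

-- Order isomorphism survives a simultaneous rearrangement of positions; exchanging the last two
-- reduces `1-32` to an increasing pattern.
orderIsomorphic-swap : ∀ {a b c a′ b′ c′} →
  OrderIsomorphic (a ∷ c ∷ b ∷ []) (a′ ∷ c′ ∷ b′ ∷ []) →
  OrderIsomorphic (a ∷ b ∷ c ∷ []) (a′ ∷ b′ ∷ c′ ∷ [])
orderIsomorphic-swap iso = λ where
  0F               0F               → iso 0F 0F
  0F               (sucF 0F)        → iso 0F (sucF (sucF 0F))
  0F               (sucF (sucF 0F)) → iso 0F (sucF 0F)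
  (sucF 0F)        0F               → iso (sucF (sucF 0F)) 0F
  (sucF 0F)        (sucF 0F)        → iso (sucF (sucF 0F)) (sucF (sucF 0F))
  (sucF 0F)        (sucF (sucF 0F)) → iso (sucF (sucF 0F)) (sucF 0F)
  (sucF (sucF 0F)) 0F               → iso (sucF 0F) 0F
  (sucF (sucF 0F)) (sucF 0F)        → iso (sucF 0F) (sucF (sucF 0F))
  (sucF (sucF 0F)) (sucF (sucF 0F)) → iso (sucF 0F) (sucF 0F)

orderIsomorphic-1-23 : ∀ {a b c} →
  OrderIsomorphic (a ∷ b ∷ c ∷ []) 1-23 ⇔ (a < b × a < c × ¬ c ≤ b)
orderIsomorphic-1-23 = mk⇔
  (λ iso → from (iso 0F (sucF 0F)) 1<2 , from (iso 0F (sucF (sucF 0F))) (s≤s (s≤s z≤n)) ,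
           ℕ.<⇒≱ (from (iso (sucF 0F) (sucF (sucF 0F))) 2<3))
  (λ (a<b , _ , c≰b) → orderIsomorphic-increasing a<b (ℕ.≰⇒> c≰b) 1<2 2<3)
  where
  1<2 : 1 < 2
  1<2 = ℕ.≤-refl
  2<3 : 2 < 3
  2<3 = ℕ.≤-refl

orderIsomorphic-1-32 : ∀ {a b c} →
  OrderIsomorphic (a ∷ b ∷ c ∷ []) 1-32 ⇔ (a < b × a < c × ¬ b ≤ c)
orderIsomorphic-1-32 = mk⇔
  (λ iso → let a<c , a<b , b≰c = to orderIsomorphic-1-23 (orderIsomorphic-swap iso)
           in a<b , a<c , b≰c)
  (λ (a<b , a<c , b≰c) → orderIsomorphic-swap (from orderIsomorphic-1-23 (a<c , a<b , b≰c)))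

-- The differential equation of the closed form

module ClosedForm {c ℓ} (A : ExponentialℚAlgebra c ℓ) where

  open PowerSeries A
  open SeriesProperties A
  private
    module A = ExponentialℚAlgebra A
    module S = CommutativeRing seriesRing
    module exp = IsMonoidHomomorphism A.exp-homomorphism
  open SetoidReasoning S.setoid

  closedForm : ℕ → Series
  closedForm k =
    if 2 ≤ᵇ k
    then (1/ (k ∸ 1) !) • (e^ (e^ x) * ∫ (x ^ (k ∸ 1) * e^ (- (e^ x) + x)))
    else e^ (e^ x - 1#)

  egf-recurrence : ∀ (g h : ℕ → ℕ) → (∀ n → g (suc n) ≡ binomialTransform (λ i → g i ℕ.+ h i) n) →
                   D (egf g) ≈ e^ x * egf g + e^ x * egf h
  egf-recurrence g h g-suc = begin
    D (egf g)                                        ≈⟨ D-egf g ⟩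
    egf (g ∘ suc)                                    ≈⟨ egf-cong g-suc ⟩
    egf (binomialTransform (λ i → g i ℕ.+ h i))      ≈⟨ e^x-*-egf (λ i → g i ℕ.+ h i) ⟨
    e^ x * egf (λ i → g i ℕ.+ h i)                   ≈⟨ S.*-congˡ {e^ x} (egf-+ g h) ⟩
    e^ x * (egf g + egf h)                           ≈⟨ S.distribˡ (e^ x) (egf g) (egf h) ⟩
    e^ x * egf g + e^ x * egf h                      ∎

  -- The series is the generating function of the Bell numbers. The vanishing last term gives the
  -- equation the shape produced by `egf-recurrence`.
  D-bell : D (e^ (e^ x - 1#)) ≈ e^ x * e^ (e^ x - 1#) + e^ x * egf (completing 0)
  D-bell = begin
    D G                            ≈⟨ D-e^ (e^ x - 1#) ⟩
    G * D (e^ x - 1#)              ≈⟨ S.*-congˡ {G} (D-+ (e^ x) (- 1#)) ⟩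
    G * (D (e^ x) + D (- 1#))      ≈⟨ S.*-congˡ {G} (S.+-cong {D (e^ x)} D-e^x D-1) ⟩
    G * (e^ x + 0#)                ≈⟨ S.*-congˡ {G} (S.+-identityʳ (e^ x)) ⟩
    G * e^ x                       ≈⟨ S.*-comm G (e^ x) ⟩
    e^ x * G                       ≈⟨ S.+-identityʳ (e^ x * G) ⟨
    e^ x * G + 0#                  ≈⟨ S.+-congˡ {e^ x * G} (S.zeroʳ (e^ x)) ⟨
    e^ x * G + e^ x * 0#           ≈⟨ S.+-congˡ {e^ x * G} (S.*-congˡ {e^ x} egf-0) ⟨
    e^ x * G + e^ x * egf (completing 0) ∎
    where
    G = e^ (e^ x - 1#)

    D-1 : D (- 1#) ≈ 0#
    D-1 = begin
      D (- 1#)  ≈⟨ D-- 1# ⟩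
      - D 1#    ≈⟨ S.-‿cong {D 1#} (D-const A.1#) ⟩
      - 0#      ≈⟨ RingProperties.-0#≈0# S.ring ⟩
      0#        ∎

    egf-0 : egf (completing 0) ≈ 0#
    egf-0 n = A.trans (frac-0 (n !)) (A.sym (const-0 n))
      where instance _ = n !≢0

  bell-0 : (e^ (e^ x - 1#)) 0 A.≈ A.1#
  bell-0 = A.trans (e^-0 (e^ x - 1#)) (A.trans (exp.⟦⟧-cong
    (A.trans (A.+-congʳ e^x-0) (A.-‿inverseʳ A.1#))) exp.ε-homo)

  -- Variation of constants: `U` solves the homogeneous equation, and the integrand of `V` is the
  -- power of `x` times `W`, which acts as `e^ x` divided by `U`.
  D-closedForm : ∀ d → let G = closedForm (suc (suc d)) in
                 D G ≈ e^ x * G + e^ x * egf (completing (suc d))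
  D-closedForm d = begin
    D (r • (U * V))
      ≈⟨ D-scale _ (U * V) ⟩
    r • D (U * V)
      ≈⟨ •-cong (D-* U V) ⟩
    r • (D U * V + U * D V)
      ≈⟨ •-cong (S.+-cong {D U * V} (S.*-congʳ {V} D-U) (S.*-congˡ {U} (D-∫ (x ^ suc d * W)))) ⟩
    r • (U * e^ x * V + U * (x ^ suc d * W))
      ≈⟨ •-cong (regroup U (e^ x) V (x ^ suc d) W) ⟩
    r • (U * V * e^ x + x ^ suc d * (U * W))
      ≈⟨ •-cong (S.+-congˡ {U * V * e^ x} (S.*-congˡ {x ^ suc d} U*W)) ⟩
    r • (U * V * e^ x + x ^ suc d * e^ x)
      ≈⟨ (λ n → A.distribˡ _ _ _) ⟩
    r • (U * V * e^ x) + r • (x ^ suc d * e^ x)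
      ≈⟨ S.+-cong {(r • (U * V)) * e^ x} (scale-* _ (U * V) (e^ x)) (scale-* _ (x ^ suc d) (e^ x)) ⟨
    (r • (U * V)) * e^ x + (r • (x ^ suc d)) * e^ x
      ≈⟨ S.+-cong {(r • (U * V)) * e^ x} (S.*-comm (r • (U * V)) (e^ x))
           (S.*-comm (r • (x ^ suc d)) (e^ x)) ⟩
    e^ x * (r • (U * V)) + e^ x * (r • (x ^ suc d))
      ≈⟨ S.+-congˡ {e^ x * (r • (U * V))} (S.*-congˡ {e^ x} (egf-kronecker (suc d))) ⟨
    e^ x * (r • (U * V)) + e^ x * egf (kronecker (suc d)) ∎
    where
    r = 1/ suc d !
    U = e^ (e^ x)
    W = e^ (- (e^ x) + x)
    V = ∫ (x ^ suc d * W)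

    •-cong : ∀ {f g} → f ≈ g → r • f ≈ r • g
    •-cong p n = A.*-congˡ (p n)

    D-U : D U ≈ U * e^ x
    D-U = S.trans {D U} (D-e^ (e^ x)) (S.*-congˡ {U} D-e^x)

    -- The constant terms of the two exponents are opposite, so their images under `exp` cancel.
    U*W : U * W ≈ e^ x
    U*W = e^-+ {e^ x} {(- (e^ x)) + x} (begin
      e^ x + (- (e^ x) + x)  ≈⟨ S.+-assoc (e^ x) (- (e^ x)) x ⟨
      e^ x + - (e^ x) + x    ≈⟨ S.+-congʳ {x} (S.-‿inverseʳ (e^ x)) ⟩
      0# + x                 ≈⟨ S.+-identityˡ x ⟩
      x                      ∎)

    regroup : ∀ u v w y z → u * v * w + u * (y * z) ≈ u * w * v + y * (u * z)
    regroup u v w y z = S.+-cong {u * v * w}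
      (begin
        u * v * w    ≈⟨ S.*-assoc u v w ⟩
        u * (v * w)  ≈⟨ S.*-congˡ {u} (S.*-comm v w) ⟩
        u * (w * v)  ≈⟨ S.*-assoc u w v ⟨
        u * w * v    ∎)
      (begin
        u * (y * z)  ≈⟨ S.*-assoc u y z ⟨
        u * y * z    ≈⟨ S.*-congʳ {z} (S.*-comm u y) ⟩
        y * u * z    ≈⟨ S.*-assoc y u z ⟩
        y * (u * z)  ∎)

  -- The integral starts at zero, and so has no constant term.
  closedForm-0 : ∀ d → closedForm (suc (suc d)) 0 A.≈ A.0#
  closedForm-0 d = A.trans (A.*-congˡ (A.trans (A.+-identityʳ _) (A.zeroʳ _))) (A.zeroʳ _)

  egf≈closedForm : ∀ d (g : ℕ → ℕ) → g 0 ≡ kronecker d 0 →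
    (∀ n → g (suc n) ≡ binomialTransform (λ i → g i ℕ.+ completing d i) n) →
    egf g ≈ closedForm (suc d)
  egf≈closedForm zero g g₀ g-suc = linearODE-unique {a = e^ x} {h = e^ x * egf (completing 0)}
    (egf-recurrence g (completing 0) g-suc) D-bell
    (A.trans (A.reflexive (cong (λ a → frac a 1) g₀)) (A.trans frac-1 (A.sym bell-0)))
  egf≈closedForm (suc d) g g₀ g-suc =
    linearODE-unique {a = e^ x} {h = e^ x * egf (completing (suc d))}
    (egf-recurrence g (completing (suc d)) g-suc) (D-closedForm d)
    (A.trans (A.reflexive (cong (λ a → frac a 1) g₀)) (A.trans (frac-0 1) (A.sym (closedForm-0 d))))

-- Specialization to the two patterns

module Permutations₁₋₂₃ =
  Permutations 1-23 Fin._≥_ ≥-isDecTotalOrder (λ _ _ _ → orderIsomorphic-1-23)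
module Permutations₁₋₃₂ =
  Permutations 1-32 Fin._≤_ Fin.≤-isDecTotalOrder (λ _ _ _ → orderIsomorphic-1-32)

proposition4 : ∀ {c ℓ} (A : ExponentialℚAlgebra c ℓ) → let open PowerSeries A in
    (k : ℕ) → 1 ≤ k →
    let closedForm : Series
        closedForm =
          if 2 ≤ᵇ k
          then (1/ (k ∸ 1) !) • (e^ (e^ x) * ∫ (x ^ (k ∸ 1) * e^ (- (e^ x) + x)))
          else e^ (e^ x - 1#)
    in (E (descending k) 1-23 ≈ closedForm) ×
       (E (descending k) 1-32 ≈ closedForm)
proposition4 A (suc d) _ =
  egf≈closedForm d (N (descending (suc d)) 1-23) R₁.count-zero R₁.count-suc ,
  egf≈closedForm d (N (descending (suc d)) 1-32) R₂.count-zero R₂.count-suc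
  where
  open ClosedForm A
  module R₁ = Permutations₁₋₂₃.Recurrence d (N (descending (suc d)) 1-23)
    (Permutations₁₋₂₃.size-allFin d)
  module R₂ = Permutations₁₋₃₂.Recurrence d (N (descending (suc d)) 1-32)
    (Permutations₁₋₃₂.size-allFin d)
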